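{- Let $w\in S_n$ be fireworks. Then $\mathrm{supp}(\mathfrak{G}_w^{\mathrm{top}})=\{\mathrm{wt}(\overline{D(w)})\}$.
   Context: Permutations are written in one-line notation; $ws_j$ is $w$ with entries in positions $j,j+1$ swapped. With $\partial_j f=\frac{f-f(x_1,\ldots,x_{j+1},x_j,\ldots,x_n)}{x_j-x_{j+1}}$ and $\overline{\partial}_jf=\partial_j((1-x_{j+1})f)$, the Grothendieck polynomial is defined by $\mathfrak{G}_{w_0}=x_1^{n-1}x_2^{n-2}\cdots x_{n-1}$ for $w_0=n(n-1)\cdots1$ and $\mathfrak{G}_w=\overline{\partial}_j\mathfrak{G}_{ws_j}$ whenever $w(j)<w(j+1)$. $\mathfrak{G}_w^{\mathrm{top}}$ denotes the highest-degree nonzero homogeneous component of $\mathfrak{G}_w$, and $\mathrm{supp}(f)$ is the set of exponent vectors of monomials with nonzero coefficient in $f$. A permutation is fireworks if the first elements of its decreasing runs (maximal consecutive decreasing blocks of $w(1)\cdots w(n)$) occur in increasing order. The Rothe diagram is $D(w)=\{(i,j)\in[n]\times[n]: i<w^{ -1}(j),\ j<w(i)\}$; the upper closure of a diagram $D$ is $\overline{D}=\{(i,j): i\le i'\text{ for some }(i',j)\in D\}$; $\mathrm{wt}(D)\in\mathbb{Z}^n$ has $i$th entry the number of boxes of $D$ in row $i$. -}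

module Defs where

open import Data.Nat as ℕ using (ℕ; zero; suc; _∸_)
open import Data.Integer as ℤ using (ℤ; +_; -_)
open import Data.Fin as Fin using (Fin; toℕ; _≟_; _<?_; _≤?_)
open import Data.Fin.Properties using (any?)
open import Data.Vec as Vec using (Vec; lookup; tabulate; zipWith; replicate)
open import Data.Vec.Properties using (≡-dec)
open import Data.List as List using (List; []; _∷_; _++_; map; concatMap; filter; length; allFin)
open import Data.Product using (Σ; ∃; ∃-syntax; _×_; _,_)
open import Data.Sum using (_⊎_; inj₁; inj₂)
open import Relation.Nullary using (Dec; yes; no; ¬_)
open import Relation.Nullary.Decidable using (_×-dec_)
open import Relation.Binary.PropositionalEquality using (_≡_)

-- Polynomials in x_1,…,x_n over ℤ, as formal finite sums of terms
-- c · x^a  (a : Vec ℕ n an exponent vector; index i : Fin n ↔ x_{i+1}).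

Poly : ℕ → Set
Poly n = List (ℤ × Vec ℕ n)

module _ {n : ℕ} where

  coeff : Poly n → Vec ℕ n → ℤ
  coeff [] a = + 0
  coeff ((c , b) ∷ p) a with ≡-dec ℕ._≟_ b a
  ... | yes _ = c ℤ.+ coeff p a
  ... | no  _ = coeff p a

  _≈ₚ_ : Poly n → Poly n → Set
  p ≈ₚ q = ∀ a → coeff p a ≡ coeff q a

  _+ₚ_ : Poly n → Poly n → Poly n
  p +ₚ q = p ++ q

  -ₚ_ : Poly n → Poly n
  -ₚ p = map (λ { (c , a) → (- c , a) }) p

  _-ₚ_ : Poly n → Poly n → Poly n
  p -ₚ q = p +ₚ (-ₚ q)

  _*ₚ_ : Poly n → Poly n → Poly n
  p *ₚ q = concatMap (λ { (c , a) → map (λ { (d , b) → (c ℤ.* d , zipWith ℕ._+_ a b) }) q }) p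

  oneₚ : Poly n
  oneₚ = (+ 1 , replicate n 0) ∷ []

  var : Fin n → Poly n
  var i = (+ 1 , tabulate (λ k → unit k)) ∷ []
    where
    unit : Fin n → ℕ
    unit k with k ≟ i
    ... | yes _ = 1
    ... | no  _ = 0

  swapV : {A : Set} → Fin n → Fin n → Vec A n → Vec A n
  swapV j j' v = tabulate f
    where
    f : Fin n → _
    f k with k ≟ j | k ≟ j'
    ... | yes _ | _     = lookup v j'
    ... | no  _ | yes _ = lookup v j
    ... | no  _ | no  _ = lookup v k

  swapVars : Fin n → Fin n → Poly n → Poly n
  swapVars j j' p = map (λ { (c , a) → (c , swapV j j' a) }) p

  deg : Vec ℕ n → ℕ
  deg a = Vec.sum a

  InSuppTop : Poly n → Vec ℕ n → Set
  InSuppTop f a = ¬ (coeff f a ≡ + 0) × (∀ b → ¬ (coeff f b ≡ + 0) → deg b ℕ.≤ deg a)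

-- Permutations of {1,…,n} in one-line notation, shifted to values in
-- Fin n = {0,…,n-1}; w (as a vector) lists w(1) … w(n).

Perm : ℕ → Set
Perm n = Vec (Fin n) n

module _ {n : ℕ} where

  IsPermutation : Perm n → Set
  IsPermutation w = ∀ i k → lookup w i ≡ lookup w k → i ≡ k

  w₀ : Perm n
  w₀ = tabulate Fin.opposite

  xδ : Poly n
  xδ = (+ 1 , tabulate (λ i → n ∸ suc (toℕ i))) ∷ []

  -- "IsGroth w f": f is (a representation of) the Grothendieck polynomial
  -- of w, following the recursive definition:
  --  𝔊_{w₀} = x^δ, and 𝔊_w = ∂̄_j 𝔊_{w s_j} whenever w(j) < w(j+1),
  -- where g = ∂̄_j f = ∂_j((1-x_{j+1}) f) is characterized as the (unique)
  -- polynomial with (x_j - x_{j+1}) g = h - s_j h,  h = (1 - x_{j+1}) f.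
  data IsGroth : Perm n → Poly n → Set where
    base : ∀ {f} → f ≈ₚ xδ → IsGroth w₀ f
    step : ∀ (w : Perm n) (j j' : Fin n) (f g : Poly n) →
           toℕ j' ≡ suc (toℕ j) →
           lookup w j Fin.< lookup w j' →
           IsGroth (swapV j j' w) f →
           ((var j -ₚ var j') *ₚ g) ≈ₚ
             (((oneₚ -ₚ var j') *ₚ f) -ₚ swapVars j j' ((oneₚ -ₚ var j') *ₚ f)) →
           IsGroth w g

  IsRunStart : Perm n → Fin n → Set
  IsRunStart w i = toℕ i ≡ 0 ⊎ (∃[ k ] (toℕ i ≡ suc (toℕ k) × lookup w k Fin.< lookup w i))

  Fireworks : Perm n → Set
  Fireworks w = ∀ i i' → IsRunStart w i → IsRunStart w i' → i Fin.< i' →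
                lookup w i Fin.< lookup w i'

  -- Rothe diagram: (i , j) ∈ D(w) iff i < w⁻¹(j) and j < w(i)
  -- (rows = positions, columns = values, both 0-based)
  InD : Perm n → Fin n → Fin n → Set
  InD w i j = (∃[ k ] (lookup w k ≡ j × i Fin.< k)) × j Fin.< lookup w i

  InClosureD : Perm n → Fin n → Fin n → Set
  InClosureD w i j = ∃[ i' ] (i Fin.≤ i' × InD w i' j)

  InD? : ∀ w i j → Dec (InD w i j)
  InD? w i j = any? (λ k → (lookup w k ≟ j) ×-dec (i <? k)) ×-dec (j <? lookup w i)

  InClosureD? : ∀ w i j → Dec (InClosureD w i j)
  InClosureD? w i j = any? (λ i' → (i ≤? i') ×-dec InD? w i' j)

  wtClosureD : Perm n → Vec ℕ n
  wtClosureD w = tabulate (λ i → length (filter (InClosureD? w i) (allFin n)))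

{-# OPTIONS --safe #-}
-- Up to signs, 𝔊_w counts (Fomin–Kirillov) the ways to write w as a product in the 0-Hecke monoid, reading the factors
--   A₁(x₁) A₂(x₂) ⋯ Aₙ₋₁(xₙ₋₁),   Aᵢ(x) = (1 + x uₙ₋₁) ⋯ (1 + x uᵢ),
-- from the identity. Since Aᵢ(x) and Aᵢ(y) commute, these counts satisfy the recursion defining 𝔊_w.
-- Let cᵢ be the number of entries of w(i+1) ⋯ w(n) that are not left-to-right maxima of w(i) ⋯ w(n); for a permutation,
-- c = wt of the upper closure of D(w). The number of uⱼ applied in row i is at most the value of cᵢ at the current word,
-- which the later factors do not lower, so every exponent vector is ≤ c. If w is fireworks, applying every uⱼ that creates
-- no inversion outside w skips in row i at most one uⱼ per ascent of w(i) ⋯ w(n); hence at least cᵢ are applied, and c occurs.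
module Submission where

open import Defs
open import Data.Bool as Bool using (true; false; if_then_else_)
open import Data.Empty using (⊥)
open import Data.Fin as Fin using (Fin; toℕ; zero; suc; opposite; inject₁; punchOut)
open import Data.Fin.Properties as Fin
  using (toℕ-injective; toℕ-inject₁; toℕ-fromℕ; toℕ<n; any?; punchOut-injective; injective⇒≤)
open import Data.Integer as ℤ using (ℤ; +_; 0ℤ; 1ℤ)
import Data.Integer.Properties as ℤ
open import Algebra.Properties.AbelianGroup ℤ.+-0-abelianGroup using (∙-cancelʳ)
open import Data.Integer.Tactic.RingSolver renaming (solve-∀ to solveℤ-∀)
open import Data.List as List using (List; []; _∷_; _++_)
open import Data.List.Membership.Propositional using () renaming (_∈_ to _∈ₗ_)
open import Data.List.Membership.Propositional.Properties using (∈-∃++; ∈-tabulate⁺; ∈-allFin)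
open import Data.List.Properties using (++-identityʳ; filter-accept; filter-reject)
open import Data.List.Relation.Binary.Permutation.Propositional using (_↭_; ↭-refl; ↭-trans; ↭-sym; prep; ↭⇒↭ₛ)
import Data.List.Relation.Binary.Permutation.Propositional.Properties as ↭
import Data.List.Relation.Binary.Permutation.Setoid.Properties as ↭ₛ
open import Data.List.Relation.Binary.Subset.Propositional using (_⊆_)
import Data.List.Relation.Unary.AllPairs as Listᴾ
open import Data.List.Relation.Unary.Any using () renaming (here to hereₗ; there to thereₗ)
open import Data.List.Relation.Unary.Unique.Propositional using (Unique)
open import Data.List.Relation.Unary.Unique.Propositional.Properties using (tabulate⁺; allFin⁺; Unique[x∷xs]⇒x∉xs)
open import Data.Nat as ℕ
  using (ℕ; zero; suc; _+_; _∸_; _≤_; _<_; _⊔_; _⊓_; z≤n; s≤s; z<s; s≤s⁻¹; _≡ᵇ_)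
open import Data.Nat.Properties
open import Data.Nat.Tactic.RingSolver using (solve-∀)
open import Data.Product using (∃-syntax; _×_; _,_; proj₁; proj₂)
open import Data.Sum using (_⊎_; inj₁; inj₂)
open import Data.Unit using (⊤; tt)
open import Data.Vec as Vec using (Vec; []; _∷_; _∷ʳ_; lookup; replicate; tabulate; zipWith)
open import Data.Vec.Membership.Propositional using (_∈_)
open import Data.Vec.Membership.Propositional.Properties using (∈-map⁺; ∈-lookup)
open import Data.Vec.Properties using (≡-dec; tabulate∘lookup; tabulate-cong; zipWith-identityˡ)
open import Data.Vec.Relation.Binary.Pointwise.Inductive using (Pointwise; []; _∷_)
open import Data.Vec.Relation.Unary.All as All using (All; []; _∷_)
open import Data.Vec.Relation.Unary.AllPairs as AllPairs using (AllPairs; []; _∷_)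
open import Data.Vec.Relation.Unary.Any using (here; there)
open import Function using (_∘_)
open import Relation.Binary.PropositionalEquality hiding (J)
open import Relation.Nullary using (¬_; Dec; yes; no; contradiction)
open import Relation.Unary using (Decidable)

-- The hypothesis on 𝔊_w is an equation for a quotient, (x_j - x_{j+1}) g = h - s_j h, not a
-- formula. The counts are shown to solve that equation, and multiplication by x_j - x_{j+1} is
-- injective. Counting in ℕ is essential: the substitution x ↦ -x makes every coefficient
-- nonnegative, so nothing cancels and a coefficient is nonzero exactly when some subword produces
-- it. Only individual subwords have to be studied after that. The price is the lack of subtraction,
-- so identities such as the commutation of rows are proved between sums with extra terms on both
-- sides. The monoid occurs only through its action on words, and products of factors are operators
-- on functions of words. Each row thus settles one letter at the front, and both bounds become
-- inductions along the word. Since uⱼ is idempotent, a factor can also be used on a pair that is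
-- already decreasing; this lets the exponents sum to more than the number of inversions.

private
  variable
    k m n N : ℕ
    A : Set

-- The 0-Hecke action and the commutation of rows

swapAt : ℕ → Vec A n → Vec A n
swapAt zero (a ∷ b ∷ v) = b ∷ a ∷ v
swapAt zero v = v
swapAt (suc j) [] = []
swapAt (suc j) (a ∷ v) = a ∷ swapAt j v

swapAt-involutive : ∀ j (v : Vec A n) → swapAt j (swapAt j v) ≡ v
swapAt-involutive zero [] = refl
swapAt-involutive zero (_ ∷ []) = refl
swapAt-involutive zero (_ ∷ _ ∷ _) = refl
swapAt-involutive (suc j) [] = refl
swapAt-involutive (suc j) (a ∷ v) = cong (a ∷_) (swapAt-involutive j v)

-- Multiplication by x_i of a power series given by its coefficients; o is the zero coefficient.
shift : A → ℕ → (Vec ℕ n → A) → Vec ℕ n → A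
shift o _ f [] = o
shift o zero f (zero ∷ a) = o
shift o zero f (suc k ∷ a) = f (k ∷ a)
shift o (suc i) f (k ∷ a) = shift o i (f ∘ (k ∷_)) a

module _ {o : A} where

  shift-cong : ∀ i {f g : Vec ℕ n → A} → f ≗ g → shift o i f ≗ shift o i g
  shift-cong i e [] = refl
  shift-cong zero e (zero ∷ a) = refl
  shift-cong zero e (suc k ∷ a) = e (k ∷ a)
  shift-cong (suc i) e (k ∷ a) = shift-cong i (e ∘ (k ∷_)) a

  shift-o : ∀ i (a : Vec ℕ n) → shift o i (λ _ → o) a ≡ o
  shift-o i [] = refl
  shift-o zero (zero ∷ a) = refl
  shift-o zero (suc _ ∷ a) = refl
  shift-o (suc i) (_ ∷ a) = shift-o i a

  shift-comm : ∀ i j (f : Vec ℕ n → A) → shift o i (shift o j f) ≗ shift o j (shift o i f)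
  shift-comm i j f [] = refl
  shift-comm zero zero f (k ∷ a) = refl
  shift-comm zero (suc j) f (zero ∷ a) = sym (shift-o j a)
  shift-comm zero (suc j) f (suc k ∷ a) = refl
  shift-comm (suc i) zero f (zero ∷ a) = shift-o i a
  shift-comm (suc i) zero f (suc k ∷ a) = refl
  shift-comm (suc i) (suc j) f (k ∷ a) = shift-comm i j (f ∘ (k ∷_)) a

  shift-swap : ∀ j (f : Vec ℕ n → A) → suc j < n →
               shift o j f ∘ swapAt j ≗ shift o (suc j) (f ∘ swapAt j)
  shift-swap zero f lt (k ∷ []) = contradiction lt λ { (s≤s ()) }
  shift-swap zero f lt (k ∷ zero ∷ a) = refl
  shift-swap zero f lt (k ∷ suc l ∷ a) = refl
  shift-swap (suc j) f lt (k ∷ a) = shift-swap j (f ∘ (k ∷_)) (s≤s⁻¹ lt) a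

  shift-swap′ : ∀ j (f : Vec ℕ n → A) → suc j < n →
                shift o (suc j) f ∘ swapAt j ≗ shift o j (f ∘ swapAt j)
  shift-swap′ zero f lt (k ∷ []) = contradiction lt λ { (s≤s ()) }
  shift-swap′ zero f lt (zero ∷ l ∷ a) = refl
  shift-swap′ zero f lt (suc k ∷ l ∷ a) = refl
  shift-swap′ (suc j) f lt (k ∷ a) = shift-swap′ j (f ∘ (k ∷_)) (s≤s⁻¹ lt) a

  shift-swap-< : ∀ i j (f : Vec ℕ n → A) → i < j →
                 shift o i f ∘ swapAt j ≗ shift o i (f ∘ swapAt j)
  shift-swap-< i (suc j) f lt [] = refl
  shift-swap-< zero (suc j) f lt (zero ∷ a) = refl
  shift-swap-< zero (suc j) f lt (suc k ∷ a) = refl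
  shift-swap-< (suc i) (suc j) f lt (k ∷ a) = shift-swap-< i j (f ∘ (k ∷_)) (s≤s⁻¹ lt) a

  shift-swap-> : ∀ i j (f : Vec ℕ n → A) → 2 + j ≤ i →
                 shift o i f ∘ swapAt j ≗ shift o i (f ∘ swapAt j)
  shift-swap-> i zero f le [] = refl
  shift-swap-> (suc i) zero f le (_ ∷ []) = refl
  shift-swap-> (suc zero) zero f (s≤s ()) (k ∷ l ∷ a)
  shift-swap-> (suc (suc i)) zero f le (k ∷ l ∷ a) = refl
  shift-swap-> i (suc j) f le [] = refl
  shift-swap-> (suc i) (suc j) f le (k ∷ a) = shift-swap-> i j (f ∘ (k ∷_)) (s≤s⁻¹ le) a

Series : ℕ → Set
Series n = Vec ℕ n → ℕ

X : ℕ → Series n → Series n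
X = shift 0

_⊕_ : Series n → Series n → Series n
(f ⊕ g) a = f a + g a

infixl 6 _⊕_

X-⊕ : ∀ i (f g : Series n) → X i (f ⊕ g) ≗ X i f ⊕ X i g
X-⊕ i f g [] = refl
X-⊕ zero f g (zero ∷ a) = refl
X-⊕ zero f g (suc k ∷ a) = refl
X-⊕ (suc i) f g (k ∷ a) = X-⊕ i (f ∘ (k ∷_)) (g ∘ (k ∷_)) a

-- The action of uⱼ on words: sorts the entries at j and j + 1 into decreasing order.
π : ℕ → Vec ℕ N → Vec ℕ N
π zero (a ∷ b ∷ v) = a ⊔ b ∷ a ⊓ b ∷ v
π zero v = v
π (suc j) [] = []
π (suc j) (a ∷ v) = a ∷ π j v

π-idem : ∀ j (v : Vec ℕ N) → π j (π j v) ≡ π j v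
π-idem zero [] = refl
π-idem zero (_ ∷ []) = refl
π-idem zero (a ∷ b ∷ v) = cong₂ (λ x y → x ∷ y ∷ v)
  (m≥n⇒m⊔n≡m (m⊓n≤m⊔n a b)) (m≥n⇒m⊓n≡n (m⊓n≤m⊔n a b))
π-idem (suc j) [] = refl
π-idem (suc j) (a ∷ v) = cong (a ∷_) (π-idem j v)

π-comm : ∀ j d (v : Vec ℕ N) → π j (π (2 + d + j) v) ≡ π (2 + d + j) (π j v)
π-comm zero d [] = refl
π-comm zero d (_ ∷ []) = refl
π-comm zero d (_ ∷ _ ∷ _) = refl
π-comm (suc j) d [] = refl
π-comm (suc j) d (a ∷ v) rewrite +-suc d j = cong (a ∷_) (π-comm j d v)

π-braid : ∀ j (v : Vec ℕ N) → π j (π (suc j) (π j v)) ≡ π (suc j) (π j (π (suc j) v))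
π-braid zero [] = refl
π-braid zero (_ ∷ []) = refl
π-braid zero (a ∷ b ∷ []) = π-idem zero (a ∷ b ∷ [])
π-braid zero (a ∷ b ∷ c ∷ v) = cong₂ _∷_ top (cong₂ (λ x y → x ∷ y ∷ v) mid bot)
  where
  open ≡-Reasoning
  top : (a ⊔ b) ⊔ (a ⊓ b ⊔ c) ≡ a ⊔ (b ⊔ c)
  top = begin
    (a ⊔ b) ⊔ (a ⊓ b ⊔ c)   ≡⟨ ⊔-assoc (a ⊔ b) (a ⊓ b) c ⟨
    ((a ⊔ b) ⊔ a ⊓ b) ⊔ c   ≡⟨ cong (_⊔ c) (m≥n⇒m⊔n≡m (m⊓n≤m⊔n a b)) ⟩
    (a ⊔ b) ⊔ c             ≡⟨ ⊔-assoc a b c ⟩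
    a ⊔ (b ⊔ c) ∎
  mid : (a ⊔ b) ⊓ (a ⊓ b ⊔ c) ≡ (a ⊓ (b ⊔ c)) ⊔ (b ⊓ c)
  mid = begin
    (a ⊔ b) ⊓ (a ⊓ b ⊔ c)                 ≡⟨ ⊓-distribˡ-⊔ (a ⊔ b) (a ⊓ b) c ⟩
    ((a ⊔ b) ⊓ (a ⊓ b)) ⊔ ((a ⊔ b) ⊓ c)   ≡⟨ cong₂ _⊔_ (m≥n⇒m⊓n≡n (m⊓n≤m⊔n a b)) (⊓-distribʳ-⊔ c a b) ⟩
    (a ⊓ b) ⊔ ((a ⊓ c) ⊔ (b ⊓ c))         ≡⟨ ⊔-assoc (a ⊓ b) (a ⊓ c) (b ⊓ c) ⟨
    ((a ⊓ b) ⊔ (a ⊓ c)) ⊔ (b ⊓ c)         ≡⟨ cong (_⊔ (b ⊓ c)) (⊓-distribˡ-⊔ a b c) ⟨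
    (a ⊓ (b ⊔ c)) ⊔ (b ⊓ c) ∎
  bot : a ⊓ b ⊓ c ≡ (a ⊓ (b ⊔ c)) ⊓ (b ⊓ c)
  bot = begin
    a ⊓ b ⊓ c                    ≡⟨ ⊓-assoc a b c ⟩
    a ⊓ (b ⊓ c)                  ≡⟨ cong (a ⊓_) (m≥n⇒m⊓n≡n (m⊓n≤m⊔n b c)) ⟨
    a ⊓ ((b ⊔ c) ⊓ (b ⊓ c))      ≡⟨ ⊓-assoc a (b ⊔ c) (b ⊓ c) ⟨
    (a ⊓ (b ⊔ c)) ⊓ (b ⊓ c) ∎
π-braid (suc j) [] = refl
π-braid (suc j) (a ∷ v) = cong (a ∷_) (π-braid j v)

-- The monoid acts on functions of words by precomposition, so in a composite of operators the
-- outermost factor is the first to move the argument word.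
Θ : ℕ → ℕ → Set
Θ N n = Vec ℕ N → Series n

_≐_ : Θ N n → Θ N n → Set
θ ≐ η = ∀ v → θ v ≗ η v

infix 4 _≐_

≐-trans : {θ η ζ : Θ N n} → θ ≐ η → η ≐ ζ → θ ≐ ζ
≐-trans p q v a = trans (p v a) (q v a)

≐-sym : {θ η : Θ N n} → θ ≐ η → η ≐ θ
≐-sym p v a = sym (p v a)

u : ℕ → Θ N n → Θ N n
u j θ v = θ (π j v)

h : ℕ → ℕ → Θ N n → Θ N n
h j i θ v = θ v ⊕ X i (u j θ v)

-- The product (1 + xᵢ u_{j+k-1}) ⋯ (1 + xᵢ uⱼ): the generator with the largest index meets the word
-- first.
Row-op : ℕ → ℕ → ℕ → Θ N n → Θ N n
Row-op j zero i θ = θ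
Row-op j (suc k) i θ = Row-op (suc j) k i (h j i θ)

record IsLinear (F : Θ N n → Θ N n) : Set where
  field
    ≐-cong : ∀ {θ η} → θ ≐ η → F θ ≐ F η
    +-homo : ∀ θ η → F (λ v → θ v ⊕ η v) ≐ λ v → F θ v ⊕ F η v
    X-homo : ∀ i θ → F (λ v → X i (θ v)) ≐ λ v → X i (F θ v)

  h-expand : ∀ j i θ → F (h j i θ) ≐ λ v → F θ v ⊕ X i (F (u j θ) v)
  h-expand j i θ v a = trans (+-homo θ (λ v → X i (u j θ v)) v a)
                             (cong (λ z → F θ v a + z) (X-homo i (u j θ) v a))

open IsLinear

id-linear : IsLinear {N} {n} (λ θ → θ)
id-linear .≐-cong e = e
id-linear .+-homo _ _ _ _ = refl
id-linear .X-homo _ _ _ _ = refl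

∘-linear : {F G : Θ N n → Θ N n} → IsLinear F → IsLinear G → IsLinear (F ∘ G)
∘-linear lF lG .≐-cong e = lF .≐-cong (lG .≐-cong e)
∘-linear lF lG .+-homo θ η = ≐-trans (lF .≐-cong (lG .+-homo θ η)) (lF .+-homo _ _)
∘-linear lF lG .X-homo i θ = ≐-trans (lF .≐-cong (lG .X-homo i θ)) (lF .X-homo i _)

u-linear : ∀ j → IsLinear {N} {n} (u j)
u-linear j .≐-cong e v = e (π j v)
u-linear j .+-homo _ _ _ _ = refl
u-linear j .X-homo _ _ _ _ = refl

h-linear : ∀ j i → IsLinear {N} {n} (h j i)
h-linear j i .≐-cong e v a = cong₂ _+_ (e v a) (shift-cong i (e (π j v)) a)
h-linear j i .+-homo θ η v a = begin
  θ v a + η v a + X i (θ w ⊕ η w) a              ≡⟨ cong (λ z → θ v a + η v a + z) (X-⊕ i (θ w) (η w) a) ⟩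
  θ v a + η v a + (X i (θ w) a + X i (η w) a)    ≡⟨ +-exchange (θ v a) _ _ _ ⟩
  θ v a + X i (θ w) a + (η v a + X i (η w) a) ∎
  where
  open ≡-Reasoning
  w = π j v
  +-exchange : ∀ p q r s → p + q + (r + s) ≡ p + r + (q + s)
  +-exchange = solve-∀
h-linear j i .X-homo i′ θ v a = trans
  (cong (λ z → X i′ (θ v) a + z) (shift-comm i i′ (θ (π j v)) a))
  (sym (X-⊕ i′ (θ v) (X i (θ (π j v))) a))

Row-op-linear : ∀ j k i → IsLinear {N} {n} (Row-op j k i)
Row-op-linear j zero i = id-linear
Row-op-linear j (suc k) i = ∘-linear (Row-op-linear (suc j) k i) (h-linear j i)

-- All generators of this row are at distance at least two from uⱼ. Storing the gap as `2 + d` lets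
-- it grow along the row without carrying inequalities.
Row-op-u : ∀ j d k i (θ : Θ N n) →
           u j (Row-op (2 + d + j) k i θ) ≐ Row-op (2 + d + j) k i (u j θ)
Row-op-u j d zero i θ v a = refl
Row-op-u j d (suc k) i θ = ≐-trans (Row-op-u j (suc d) k i (h (2 + d + j) i θ))
  (Row-op-linear (3 + d + j) k i .≐-cong λ v a →
    cong (λ w → θ (π j v) a + X i (θ w) a) (sym (π-comm j d v)))

Row-op-h : ∀ j d k i i′ (θ : Θ N n) →
           h j i′ (Row-op (2 + d + j) k i θ) ≐ Row-op (2 + d + j) k i (h j i′ θ)
Row-op-h j d k i i′ θ v a = begin
  F θ v a + X i′ (u j (F θ) v) a   ≡⟨ cong (λ z → F θ v a + z) (shift-cong i′ (Row-op-u j d k i θ v) a) ⟩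
  F θ v a + X i′ (F (u j θ) v) a   ≡⟨ h-expand F-linear j i′ θ v a ⟨
  F (h j i′ θ) v a ∎
  where
  open ≡-Reasoning
  F = Row-op (2 + d + j) k i
  F-linear = Row-op-linear (2 + d + j) k i

-- With W = C(x) (1 + x u₂) C(y), where C commutes with u₁, the product A(x) A(y) is W (1 + x u₁) (1 + y u₂) (1 + y u₁).
-- The series p_σ are the values of W u_σ. All terms of balance other than T are symmetric in x and y by induction, since
-- W (1 + y u₂) is; they are arranged so that no subtraction occurs.
module YangBaxter
  (x y : ℕ) (p p₁ p₂ p₂₁ p₁₂ p₁₂₁ : Series n) where

  E₁ E₃ T : Series n
  E₁ = p₁ ⊕ X y p₂₁
  E₃ = p₁₂ ⊕ X y p₁₂₁
  T = (p ⊕ X y p₁) ⊕ X y (p₂ ⊕ X y p₂₁)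
      ⊕ X x ((p₁ ⊕ X y p₁) ⊕ X y (p₁₂ ⊕ X y p₁₂₁))

  balance : T ⊕ X x (X y (p₂₁ ⊕ X y p₂₁)) ≗
            (p ⊕ X y p₂) ⊕ X x E₁ ⊕ X y E₁ ⊕ X x (X y E₁) ⊕ X x (X y E₃)
  balance a
    rewrite X-⊕ y p₂ (X y p₂₁) a
          | X-⊕ x (p₁ ⊕ X y p₁) (X y (p₁₂ ⊕ X y p₁₂₁)) a
          | X-⊕ x p₁ (X y p₁) a
          | shift-cong {o = 0} x (X-⊕ y p₁₂ (X y p₁₂₁)) a
          | X-⊕ x (X y p₁₂) (X y (X y p₁₂₁)) a
          | shift-cong {o = 0} x (X-⊕ y p₂₁ (X y p₂₁)) a
          | X-⊕ x (X y p₂₁) (X y (X y p₂₁)) a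
          | X-⊕ x p₁ (X y p₂₁) a
          | X-⊕ y p₁ (X y p₂₁) a
          | shift-cong {o = 0} x (X-⊕ y p₁ (X y p₂₁)) a
          | X-⊕ x (X y p₁) (X y (X y p₂₁)) a
    = rearrange (p a) (X y p₁ a) (X y p₂ a) (X y (X y p₂₁) a) (X x p₁ a) (X x (X y p₁) a)
                (X x (X y p₁₂) a) (X x (X y (X y p₁₂₁)) a) (X x (X y p₂₁) a) (X x (X y (X y p₂₁)) a)
    where
    rearrange : ∀ a b c d e f g h i j →
      a + b + (c + d) + (e + f + (g + h)) + (i + j) ≡
      a + c + (e + i) + (b + d) + (f + j) + (g + h)
    rearrange = solve-∀

Commute : (N n j k : ℕ) → Set
Commute N n j k = ∀ x y (θ : Θ N n) →
  Row-op j k x (Row-op j k y θ) ≐ Row-op j k y (Row-op j k x θ)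

Row-op-comm-step : ∀ j k → Commute N n (suc j) (suc k) → Commute N n j (2 + k)
Row-op-comm-step {N} {n} j k comm x y θ v a = begin
  Row-op j (2 + k) x (Row-op j (2 + k) y θ) v a   ≡⟨ expand x y v a ⟩
  T a                                             ≡⟨ +-cancelʳ-≡ _ (T a) (T′ a) T+R≡T′+R ⟩
  T′ a                                            ≡⟨ expand y x v a ⟨
  Row-op j (2 + k) y (Row-op j (2 + k) x θ) v a ∎
  where
  open ≡-Reasoning
  C : ℕ → Θ N n → Θ N n
  C = Row-op (2 + j) k
  W : ℕ → ℕ → Θ N n → Θ N n
  W x y η = C x (h (suc j) x (C y η))
  W-linear : ∀ x y → IsLinear (W x y)
  W-linear x y = ∘-linear (Row-op-linear (2 + j) k x) (∘-linear (h-linear (suc j) x) (Row-op-linear (2 + j) k y))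
  θ₁ = u j θ
  θ₂ = u (suc j) θ
  θ₂₁ = u (suc j) θ₁
  θ₁₂ = u j θ₂
  θ₁₂₁ = u j θ₂₁
  module Y (x y : ℕ) (v : Vec ℕ N) = YangBaxter x y (W x y θ v) (W x y θ₁ v) (W x y θ₂ v)
    (W x y θ₂₁ v) (W x y θ₁₂ v) (W x y θ₁₂₁ v)
  open Y x y v using (T; E₁; E₃; balance)
  open Y y x v using () renaming (T to T′; E₁ to E₁′; E₃ to E₃′; balance to balance′)

  expand : ∀ x y v a → Row-op j (2 + k) x (Row-op j (2 + k) y θ) v a ≡ Y.T x y v a
  expand x y v a = begin
    C x (h (suc j) x (h j x (C y (h (suc j) y (h j y θ))))) v a
      ≡⟨ Row-op-linear (2 + j) k x .≐-cong (h-linear (suc j) x .≐-cong (Row-op-h j 0 k y x _)) v a ⟩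
    W x y (h j x (h (suc j) y (h j y θ))) v a
      ≡⟨ h-expand lW j x _ v a ⟩
    (F (h (suc j) y (h j y θ)) v ⊕ X x (F (u j (h (suc j) y (h j y θ))) v)) a
      ≡⟨ cong₂ _+_ (first v a) (shift-cong x (second v) a) ⟩
    Y.T x y v a ∎
    where
    F = W x y
    lW = W-linear x y
    first : F (h (suc j) y (h j y θ)) ≐ λ v → (F θ v ⊕ X y (F θ₁ v)) ⊕ X y (F θ₂ v ⊕ X y (F θ₂₁ v))
    first v a = trans (h-expand lW (suc j) y (h j y θ) v a)
      (cong₂ _+_ (h-expand lW j y θ v a)
        (shift-cong y (h-expand (∘-linear lW (u-linear (suc j))) j y θ v) a))
    second : F (u j (h (suc j) y (h j y θ))) ≐
             λ v → (F θ₁ v ⊕ X y (F θ₁ v)) ⊕ X y (F θ₁₂ v ⊕ X y (F θ₁₂₁ v))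
    second v a = trans (h-expand l₁ (suc j) y (h j y θ) v a)
      (cong₂ _+_
        (trans (h-expand l₁ j y θ v a)
          (cong (λ z → F θ₁ v a + z) (shift-cong y (lW .≐-cong (λ w b → cong (λ z → θ z b) (π-idem j w)) v) a)))
        (shift-cong y (h-expand (∘-linear l₁ (u-linear (suc j))) j y θ v) a))
      where l₁ = ∘-linear lW (u-linear j)

  -- Commutation of the shorter rows, which end in the factor with u₂. Its use at `θ₂₁` needs
  -- idempotence of u₂, its use at `θ₁₂` the braid relation.
  ih : ∀ η v → W x y η v ⊕ X y (W x y (u (suc j) η) v) ≗ W y x η v ⊕ X x (W y x (u (suc j) η) v)
  ih η v a = begin
    (W x y η v ⊕ X y (W x y (u (suc j) η) v)) a                ≡⟨ h-expand (W-linear x y) (suc j) y η v a ⟨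
    Row-op (suc j) (suc k) x (Row-op (suc j) (suc k) y η) v a  ≡⟨ comm x y η v a ⟩
    Row-op (suc j) (suc k) y (Row-op (suc j) (suc k) x η) v a  ≡⟨ h-expand (W-linear y x) (suc j) x η v a ⟩
    (W y x η v ⊕ X x (W y x (u (suc j) η) v)) a ∎

  E₁≗E₁′ : E₁ ≗ E₁′
  E₁≗E₁′ = ih θ₁ v

  W-u-idem : ∀ x y z → X z (W x y (u (suc j) θ₂₁) v) ≗ X z (W x y θ₂₁ v)
  W-u-idem x y z = shift-cong z (W-linear x y .≐-cong
    (λ w b → cong (λ t → θ (π j t) b) (π-idem (suc j) w)) v)

  E₂≗E₂′ : W x y θ₂₁ v ⊕ X y (W x y θ₂₁ v) ≗ W y x θ₂₁ v ⊕ X x (W y x θ₂₁ v)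
  E₂≗E₂′ b = begin
    W x y θ₂₁ v b + X y (W x y θ₂₁ v) b                ≡⟨ cong (λ z → W x y θ₂₁ v b + z) (W-u-idem x y y b) ⟨
    W x y θ₂₁ v b + X y (W x y (u (suc j) θ₂₁) v) b    ≡⟨ ih θ₂₁ v b ⟩
    W y x θ₂₁ v b + X x (W y x (u (suc j) θ₂₁) v) b    ≡⟨ cong (λ z → W y x θ₂₁ v b + z) (W-u-idem y x x b) ⟩
    W y x θ₂₁ v b + X x (W y x θ₂₁ v) b ∎

  W-braid : ∀ x y z → X z (W x y (u (suc j) θ₁₂) v) ≗ X z (W x y θ₁₂₁ v)
  W-braid x y z = shift-cong z (W-linear x y .≐-cong
    (λ w b → cong (λ t → θ t b) (sym (π-braid j w))) v)

  E₃≗E₃′ : E₃ ≗ E₃′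
  E₃≗E₃′ b = begin
    W x y θ₁₂ v b + X y (W x y θ₁₂₁ v) b               ≡⟨ cong (λ z → W x y θ₁₂ v b + z) (W-braid x y y b) ⟨
    W x y θ₁₂ v b + X y (W x y (u (suc j) θ₁₂) v) b    ≡⟨ ih θ₁₂ v b ⟩
    W y x θ₁₂ v b + X x (W y x (u (suc j) θ₁₂) v) b    ≡⟨ cong (λ z → W y x θ₁₂ v b + z) (W-braid y x x b) ⟩
    W y x θ₁₂ v b + X x (W y x θ₁₂₁ v) b ∎

  XX-cong : ∀ {f g : Series n} → f ≗ g → X x (X y f) ≗ X y (X x g)
  XX-cong {f} {g} e b = trans (shift-cong x (shift-cong y e) b) (shift-comm x y g b)

  T+R≡T′+R : T a + X x (X y (W x y θ₂₁ v ⊕ X y (W x y θ₂₁ v))) a ≡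
             T′ a + X x (X y (W x y θ₂₁ v ⊕ X y (W x y θ₂₁ v))) a
  T+R≡T′+R = begin
    T a + X x (X y (W x y θ₂₁ v ⊕ X y (W x y θ₂₁ v))) a
      ≡⟨ balance a ⟩
    e₀ + X x E₁ a + X y E₁ a + X x (X y E₁) a + X x (X y E₃) a
      ≡⟨ cong₂ _+_ (cong₂ _+_ (cong₂ _+_ (cong₂ _+_ (ih θ v a) (shift-cong x E₁≗E₁′ a))
           (shift-cong y E₁≗E₁′ a)) (XX-cong E₁≗E₁′ a)) (XX-cong E₃≗E₃′ a) ⟩
    e₀′ + X x E₁′ a + X y E₁′ a + X y (X x E₁′) a + X y (X x E₃′) a
      ≡⟨ cong (λ z → z + X y (X x E₁′) a + X y (X x E₃′) a) (exchange e₀′ _ _) ⟩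
    e₀′ + X y E₁′ a + X x E₁′ a + X y (X x E₁′) a + X y (X x E₃′) a
      ≡⟨ balance′ a ⟨
    T′ a + X y (X x (W y x θ₂₁ v ⊕ X x (W y x θ₂₁ v))) a
      ≡⟨ cong (λ z → T′ a + z) (XX-cong E₂≗E₂′ a) ⟨
    T′ a + X x (X y (W x y θ₂₁ v ⊕ X y (W x y θ₂₁ v))) a ∎
    where
    e₀ = (W x y θ v ⊕ X y (W x y θ₂ v)) a
    e₀′ = (W y x θ v ⊕ X x (W y x θ₂ v)) a
    exchange : ∀ p q r → p + q + r ≡ p + r + q
    exchange = solve-∀

Row-op-comm : ∀ j k → Commute N n j k
Row-op-comm j zero x y θ v a = refl
Row-op-comm j (suc zero) x y θ v a = begin
  θ v a + X y (θ w) a + X x (λ b → θ w b + X y (θ (π j w)) b) a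
    ≡⟨ cong (λ z → θ v a + X y (θ w) a + X x (λ b → θ w b + X y (θ z) b) a) (π-idem j v) ⟩
  θ v a + X y (θ w) a + X x (θ w ⊕ X y (θ w)) a
    ≡⟨ cong (λ z → θ v a + X y (θ w) a + z) (X-⊕ x (θ w) (X y (θ w)) a) ⟩
  θ v a + X y (θ w) a + (X x (θ w) a + X x (X y (θ w)) a)
    ≡⟨ cong (λ z → θ v a + X y (θ w) a + (X x (θ w) a + z)) (shift-comm x y (θ w) a) ⟩
  θ v a + X y (θ w) a + (X x (θ w) a + X y (X x (θ w)) a)
    ≡⟨ exchange (θ v a) _ _ _ ⟩
  θ v a + X x (θ w) a + (X y (θ w) a + X y (X x (θ w)) a)
    ≡⟨ cong (λ z → θ v a + X x (θ w) a + z) (X-⊕ y (θ w) (X x (θ w)) a) ⟨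
  θ v a + X x (θ w) a + X y (θ w ⊕ X x (θ w)) a
    ≡⟨ cong (λ z → θ v a + X x (θ w) a + X y (λ b → θ w b + X x (θ z) b) a) (π-idem j v) ⟨
  θ v a + X x (θ w) a + X y (λ b → θ w b + X x (θ (π j w)) b) a ∎
  where
  open ≡-Reasoning
  w = π j v
  exchange : ∀ p q r s → p + q + (r + s) ≡ p + r + (q + s)
  exchange = solve-∀
Row-op-comm j (suc (suc k)) = Row-op-comm-step j k (Row-op-comm (suc j) (suc k))

-- The Fomin–Kirillov product

-- With m + 1 rows left only m generators are left, so the last row is an empty product. Counting
-- from 0, row i carries the variable xᵢ and the generators from uᵢ on.
Rows : ℕ → ℕ → Θ N n → Θ N n
Rows i zero θ = θ
Rows i (suc m) θ = Row-op i m i (Rows (suc i) m θ)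

Rows-linear : ∀ i m → IsLinear {N} {n} (Rows i m)
Rows-linear i zero = id-linear
Rows-linear i (suc m) = ∘-linear (Row-op-linear i m i) (Rows-linear (suc i) m)

Rows-h : ∀ j d m i (θ : Θ N n) → h j i (Rows (2 + d + j) m θ) ≐ Rows (2 + d + j) m (h j i θ)
Rows-h j d zero i θ v a = refl
Rows-h j d (suc m) i θ = ≐-trans (Row-op-h j d m (2 + d + j) i _)
  (Row-op-linear (2 + d + j) m (2 + d + j) .≐-cong (Rows-h j (suc d) m i θ))

swapped : ℕ → Θ N n → Θ N n
swapped j θ v a = θ v (swapAt j a)

Row-op-swapped : ∀ i i′ j → (∀ (f : Series n) → X i f ∘ swapAt j ≗ X i′ (f ∘ swapAt j)) →
  ∀ k m (θ : Θ N n) → swapped j (Row-op k m i θ) ≐ Row-op k m i′ (swapped j θ)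
Row-op-swapped i i′ j X-swap k zero θ v a = refl
Row-op-swapped i i′ j X-swap k (suc m) θ = ≐-trans
  (Row-op-swapped i i′ j X-swap (suc k) m (h k i θ))
  (Row-op-linear (suc k) m i′ .≐-cong λ v a → cong (λ z → θ v (swapAt j a) + z) (X-swap (θ (π k v)) a))

-- The extra factor 1 + x_{j+1} uⱼ commutes with all rows after row j + 1 and lengthens row j + 1 to
-- Aⱼ(x_{j+1}). Rows j and j + 1 then form Aⱼ(xⱼ) Aⱼ(x_{j+1}), symmetric by commutation of rows; no
-- other row involves these two variables.
Rows-symmetric : ∀ d m i {j} {θ : Θ N n} → j ≡ d + i → suc j < n → 2 + d ≤ m →
  swapped j θ ≐ θ → swapped j (Rows i m (h j (suc j) θ)) ≐ Rows i m (h j (suc j) θ)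
Rows-symmetric zero (suc zero) i refl lt (s≤s ()) sym-θ
Rows-symmetric zero (suc (suc m)) i {θ = θ} refl lt le sym-θ v a = begin
  R i (R₁ (suc i) (Rows (2 + i) m (h i (suc i) θ))) v (swapAt i a)  ≡⟨ merge v (swapAt i a) ⟩
  R i (R (suc i) ρ) v (swapAt i a)                                  ≡⟨ to (R (suc i) ρ) v a ⟩
  R (suc i) (swapped i (R (suc i) ρ)) v a                           ≡⟨ R-linear (suc i) .≐-cong (from ρ) v a ⟩
  R (suc i) (R i (swapped i ρ)) v a                                 ≡⟨ R-linear (suc i) .≐-cong (R-linear i .≐-cong (rest m (2 + i) ≤-refl)) v a ⟩
  R (suc i) (R i ρ) v a                                             ≡⟨ Row-op-comm i (suc m) (suc i) i ρ v a ⟩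
  R i (R (suc i) ρ) v a                                             ≡⟨ merge v a ⟨
  R i (R₁ (suc i) (Rows (2 + i) m (h i (suc i) θ))) v a ∎
  where
  open ≡-Reasoning
  R = Row-op i (suc m)
  R₁ = Row-op (suc i) m
  R-linear = Row-op-linear i (suc m)
  ρ = Rows (2 + i) m θ
  merge : R i (R₁ (suc i) (Rows (2 + i) m (h i (suc i) θ))) ≐ R i (R (suc i) ρ)
  merge = R-linear i .≐-cong (Row-op-linear (suc i) m (suc i) .≐-cong (≐-sym (Rows-h i 0 m (suc i) θ)))
  to = Row-op-swapped i (suc i) i (λ f → shift-swap i f lt) i (suc m)
  from = Row-op-swapped (suc i) i i (λ f → shift-swap′ i f lt) i (suc m)
  rest : ∀ m k → 2 + i ≤ k → swapped i (Rows k m θ) ≐ Rows k m θ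
  rest zero k le = sym-θ
  rest (suc m) k le = ≐-trans (Row-op-swapped k k i (λ f → shift-swap-> k i f le) k m _)
    (Row-op-linear k m k .≐-cong (rest m (suc k) (m≤n⇒m≤1+n le)))
Rows-symmetric (suc d) (suc m) i refl lt le sym-θ = ≐-trans
  (Row-op-swapped i i _ (λ f → shift-swap-< i (suc (d + i)) f (s≤s (m≤n+m i d))) i m _)
  (Row-op-linear i m i .≐-cong (Rows-symmetric d m (suc i) (sym (+-suc d i)) lt (s≤s⁻¹ le) sym-θ))

-- A Kronecker delta with value `d` and default `o`, recursive so that it reduces on constructors;
-- it serves words and exponents, with values in ℕ or ℤ.
ind : A → A → Vec ℕ n → Vec ℕ n → A
ind o d [] [] = d
ind o d (k ∷ b) (l ∷ a) = if k ≡ᵇ l then ind o d b a else o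

≡ᵇ-refl : ∀ k → (k ≡ᵇ k) ≡ true
≡ᵇ-refl zero = refl
≡ᵇ-refl (suc k) = ≡ᵇ-refl k

module _ {o d : A} where

  ind-refl : ∀ (b : Vec ℕ n) → ind o d b b ≡ d
  ind-refl [] = refl
  ind-refl (k ∷ b) rewrite ≡ᵇ-refl k = ind-refl b

  ind-≢ : ∀ {b a : Vec ℕ n} → b ≢ a → ind o d b a ≡ o
  ind-≢ {b = []} {[]} ne = contradiction refl ne
  ind-≢ {b = k ∷ b} {l ∷ a} ne with k ≡ᵇ l in eq
  ... | false = refl
  ... | true = ind-≢ (ne ∘ cong₂ _∷_ (≡ᵇ⇒≡ k l (subst Bool.T (sym eq) _)))

bump : ℕ → Vec ℕ n → Vec ℕ n
bump j [] = []
bump zero (k ∷ b) = suc k ∷ b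
bump (suc j) (k ∷ b) = k ∷ bump j b

shift-ind : ∀ {o d : A} j (b : Vec ℕ n) → j < n → shift o j (ind o d b) ≗ ind o d (bump j b)
shift-ind zero (k ∷ b) lt (zero ∷ a) = refl
shift-ind zero (k ∷ b) lt (suc l ∷ a) = refl
shift-ind (suc j) (k ∷ b) lt (l ∷ a) with k ≡ᵇ l
... | true = shift-ind j b (s≤s⁻¹ lt) a
... | false = shift-o j a

zeros : Vec ℕ n
zeros = replicate _ 0

-- A product of factors applied to this function counts the subwords that lead from the argument
-- word to `w`: the exponent left over at the end must be zero.
target : Vec ℕ N → Θ N n
target w v a = ind 0 (ind 0 1 zeros a) w v

target-swapped : ∀ j (w : Vec ℕ N) → swapped {n = n} j (target w) ≐ target w
target-swapped j w v a = cong (λ z → ind 0 z w v) (ones-swap j a)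
  where
  ones-swap : ∀ {n} j (a : Vec ℕ n) → ind 0 1 zeros (swapAt j a) ≡ ind 0 1 zeros a
  ones-swap zero [] = refl
  ones-swap zero (_ ∷ []) = refl
  ones-swap zero (zero ∷ zero ∷ a) = refl
  ones-swap zero (zero ∷ suc _ ∷ a) = refl
  ones-swap zero (suc _ ∷ zero ∷ a) = refl
  ones-swap zero (suc _ ∷ suc _ ∷ a) = refl
  ones-swap (suc j) [] = refl
  ones-swap (suc j) (zero ∷ a) = ones-swap j a
  ones-swap (suc j) (suc _ ∷ a) = refl

-- The recursion for the counts

Ascent : ℕ → Vec ℕ n → Set
Ascent zero (a ∷ b ∷ _) = a < b
Ascent zero _ = ⊥
Ascent (suc j) [] = ⊥
Ascent (suc j) (_ ∷ v) = Ascent j v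

ascent-< : ∀ j {w : Vec ℕ n} → Ascent j w → suc j < n
ascent-< zero {_ ∷ _ ∷ _} asc = s≤s (s≤s z≤n)
ascent-< (suc j) {_ ∷ _} asc = s≤s (ascent-< j asc)

π-no-ascent : ∀ j (v : Vec ℕ n) → ¬ Ascent j (π j v)
π-no-ascent zero (a ∷ b ∷ v) asc = <⇒≱ asc (m⊓n≤m⊔n a b)
π-no-ascent (suc j) (_ ∷ v) asc = π-no-ascent j v asc

π-ascent : ∀ j (w : Vec ℕ n) → Ascent j w → π j w ≡ swapAt j w
π-ascent zero (a ∷ b ∷ w) asc = cong₂ (λ x y → x ∷ y ∷ w) (m≤n⇒m⊔n≡n (<⇒≤ asc)) (m≤n⇒m⊓n≡m (<⇒≤ asc))
π-ascent (suc j) (a ∷ w) asc = cong (a ∷_) (π-ascent j w asc)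

π-fibre : ∀ j (v : Vec ℕ n) → π j v ≡ v ⊎ π j v ≡ swapAt j v
π-fibre zero [] = inj₁ refl
π-fibre zero (_ ∷ []) = inj₁ refl
π-fibre zero (a ∷ b ∷ v) with ≤-total a b
... | inj₁ a≤b = inj₂ (cong₂ (λ x y → x ∷ y ∷ v) (m≤n⇒m⊔n≡n a≤b) (m≤n⇒m⊓n≡m a≤b))
... | inj₂ b≤a = inj₁ (cong₂ (λ x y → x ∷ y ∷ v) (m≥n⇒m⊔n≡m b≤a) (m≥n⇒m⊓n≡n b≤a))
π-fibre (suc j) [] = inj₁ refl
π-fibre (suc j) (a ∷ v) with π-fibre j v
... | inj₁ e = inj₁ (cong (a ∷_) e)
... | inj₂ e = inj₂ (cong (a ∷_) e)

-- A word with an ascent at j is not in the image of `π j`.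
u-target-ascent : ∀ j (w : Vec ℕ N) → Ascent j w → ∀ v (a : Vec ℕ n) → u j (target w) v a ≡ 0
u-target-ascent j w asc v a = ind-≢ {b = w} λ { refl → π-no-ascent j v asc }

-- The fibre of `π j` over `swapAt j w` consists of `w` and `swapAt j w`.
u-target-descent : ∀ j (w : Vec ℕ N) → Ascent j w →
  u {n = n} j (target (swapAt j w)) ≐ λ v → target w v ⊕ target (swapAt j w) v
u-target-descent {n = n} j w asc v a = helper (≡-dec ℕ._≟_ w v) (≡-dec ℕ._≟_ w′ v)
  where
  w′ = swapAt j w
  d = ind 0 1 zeros a
  πw≡w′ = π-ascent j w asc
  w≢w′ : w ≢ w′
  w≢w′ w≡w′ = π-no-ascent j w (subst (Ascent j) (trans w≡w′ (sym πw≡w′)) asc)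
  helper : Dec (w ≡ v) → Dec (w′ ≡ v) → ind 0 d w′ (π j v) ≡ ind 0 d w v + ind 0 d w′ v
  helper (yes refl) _
    rewrite πw≡w′ | ind-refl {o = 0} {d} w′ | ind-refl {o = 0} {d} w
          | ind-≢ {o = 0} {d} {b = w′} {w} (w≢w′ ∘ sym) = sym (+-identityʳ _)
  helper (no w≢v) (yes refl) = begin
    ind 0 d w′ (π j w′)         ≡⟨ cong (λ z → ind 0 d w′ (π j z)) πw≡w′ ⟨
    ind 0 d w′ (π j (π j w))    ≡⟨ cong (ind 0 d w′) (trans (π-idem j w) πw≡w′) ⟩
    ind 0 d w′ w′               ≡⟨ cong (_+ ind 0 d w′ w′) (ind-≢ {b = w} w≢v) ⟨
    ind 0 d w w′ + ind 0 d w′ w′ ∎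
    where open ≡-Reasoning
  helper (no w≢v) (no w′≢v)
    rewrite ind-≢ {o = 0} {d} {b = w} w≢v | ind-≢ {o = 0} {d} {b = w′} w′≢v
    = ind-≢ {b = w′} λ w′≡πv → no-fibre w′≡πv (π-fibre j v)
    where
    no-fibre : w′ ≡ π j v → ¬ (π j v ≡ v ⊎ π j v ≡ swapAt j v)
    no-fibre w′≡πv (inj₁ πv≡v) = w′≢v (trans w′≡πv πv≡v)
    no-fibre w′≡πv (inj₂ πv≡sv) = w≢v (trans (sym (swapAt-involutive j w))
      (trans (cong (swapAt j) (trans w′≡πv πv≡sv)) (swapAt-involutive j v)))

-- Built from the right: once the first row has carried the last and largest letter to the front,
-- the rest is literally the shorter identity word.
ids : ∀ n → Vec ℕ n
ids zero = []
ids (suc n) = ids n ∷ʳ n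

ψ : Vec ℕ n → Series n
ψ {n} w = Rows 0 n (target w) (ids n)

module _ (j : ℕ) (w : Vec ℕ n) (asc : Ascent j w) where

  private
    symmetric : (w : Vec ℕ n) → ∀ a → Rows 0 n (h j (suc j) (target w)) (ids n) (swapAt j a) ≡
                                       Rows 0 n (h j (suc j) (target w)) (ids n) a
    symmetric w = Rows-symmetric j n 0 (sym (+-identityʳ j)) (ascent-< j asc) (ascent-< j asc)
      (target-swapped j w) (ids n)

  -- For a target with an ascent at j the extra factor 1 + x_{j+1} uⱼ changes nothing, so the
  -- symmetry of the lengthened product is that of `ψ w`.
  ψ-ascent : ∀ a → ψ w (swapAt j a) ≡ ψ w a
  ψ-ascent a = trans (sym (h-trivial (swapAt j a))) (trans (symmetric w a) (h-trivial a))
    where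
    h-trivial : ∀ a → Rows 0 n (h j (suc j) (target w)) (ids n) a ≡ ψ w a
    h-trivial = Rows-linear 0 n .≐-cong (λ v a → trans
      (cong (λ z → target w v a + z) (trans (shift-cong (suc j) (u-target-ascent j w asc v) a) (shift-o (suc j) a)))
      (+-identityʳ _)) (ids n)

  -- Put H = (1 + x_{j+1}) ψ w′. With `ψ-ascent`, this symmetry reads H + x_{j+1} ψ w = sⱼH + xⱼ ψ
  -- w, the subtraction-free form of H - sⱼH = (xⱼ - x_{j+1}) ψ w.
  ψ-descent : let w′ = swapAt j w; Φ = ψ w′ ⊕ X (suc j) (ψ w ⊕ ψ w′) in
              ∀ a → Φ (swapAt j a) ≡ Φ a
  ψ-descent a = trans (sym (expand (swapAt j a))) (trans (symmetric w′ a) (expand a))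
    where
    w′ = swapAt j w
    expand : ∀ a → Rows 0 n (h j (suc j) (target w′)) (ids n) a ≡ (ψ w′ ⊕ X (suc j) (ψ w ⊕ ψ w′)) a
    expand a = trans (h-expand (Rows-linear 0 n) j (suc j) (target w′) (ids n) a)
      (cong (λ z → ψ w′ a + z) (shift-cong (suc j) (λ b → trans
        (Rows-linear 0 n .≐-cong (u-target-descent j w asc) (ids n) b)
        (Rows-linear 0 n .+-homo (target w) (target w′) (ids n) b)) a))

-- The initial condition: the longest permutation

Row-op-cons : ∀ j k i (θ : Θ (suc N) n) b v → Row-op (suc j) k i θ (b ∷ v) ≗ Row-op j k i (θ ∘ (b ∷_)) v
Row-op-cons j zero i θ b v a = refl
Row-op-cons j (suc k) i θ b v = Row-op-cons (suc j) k i (h (suc j) i θ) b v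

-- Freezes the front letter and the exponent of the first variable, which the rows after the first
-- leave alone.
slice : ℕ → ℕ → Θ (suc N) (suc n) → Θ N n
slice b t θ v a = θ (b ∷ v) (t ∷ a)

Row-op-slice : ∀ j k i (θ : Θ (suc N) (suc n)) b t →
  slice b t (Row-op (suc j) k (suc i) θ) ≐ Row-op j k i (slice b t θ)
Row-op-slice j zero i θ b t v a = refl
Row-op-slice j (suc k) i θ b t = Row-op-slice (suc j) k i (h (suc j) (suc i) θ) b t

Rows-slice : ∀ i m (θ : Θ (suc N) (suc n)) b t →
  slice b t (Rows (suc i) m θ) ≐ Rows i m (slice b t θ)
Rows-slice i zero θ b t v a = refl
Rows-slice i (suc m) θ b t = ≐-trans (Row-op-slice i m i (Rows (2 + i) m θ) b t)
  (Row-op-linear i m i .≐-cong (Rows-slice (suc i) m θ b t))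

-- If θ = 0 then θ + θ = θ, so additivity gives Fθ + Fθ = Fθ, and Fθ cancels in ℕ.
linear-0 : {F : Θ N n → Θ N n} {θ : Θ N n} → IsLinear F → (∀ v a → θ v a ≡ 0) → ∀ v a → F θ v a ≡ 0
linear-0 {F = F} {θ} lF θ≡0 v a = +-cancelˡ-≡ (F θ v a) (F θ v a) 0 (begin
  F θ v a + F θ v a             ≡⟨ lF .+-homo θ θ v a ⟨
  F (λ v → θ v ⊕ θ v) v a       ≡⟨ lF .≐-cong (λ v a → cong (_+ θ v a) (θ≡0 v a)) v a ⟩
  F θ v a                       ≡⟨ +-identityʳ _ ⟨
  F θ v a + 0 ∎)
  where open ≡-Reasoning

iter : ℕ → (A → A) → A → A
iter zero f x = x
iter (suc k) f x = iter k f (f x)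

iter-X-cong : ∀ k i {f g : Series n} → f ≗ g → iter k (X i) f ≗ iter k (X i) g
iter-X-cong zero i e = e
iter-X-cong (suc k) i e = iter-X-cong k i (shift-cong i e)

-- Only subwords that bring M to the front survive. M starts at the far end, so all `k` factors are
-- used, each contributing one xᵢ.
Row-op-max : ∀ k i {l : Vec ℕ k} {M} {θ : Θ (suc k) n} → All (_< M) l →
  (∀ b v a → b ≢ M → θ (b ∷ v) a ≡ 0) → Row-op 0 k i θ (l ∷ʳ M) ≗ iter k (X i) (θ (M ∷ l))
Row-op-max zero i {[]} [] vanish a = refl
Row-op-max (suc k) i {b ∷ l} {M} {θ} (b<M ∷ l<M) vanish a = trans
  (Row-op-cons 0 k i (h 0 i θ) b (l ∷ʳ M) a)
  (trans (Row-op-max k i l<M vanish′ a) (iter-X-cong k i first a))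
  where
  vanish′ : ∀ c v a → c ≢ M → h 0 i θ (b ∷ c ∷ v) a ≡ 0
  vanish′ c v a c≢M = cong₂ _+_ (vanish b _ a (<⇒≢ b<M))
    (trans (shift-cong i (λ a → vanish (b ⊔ c) _ a b⊔c≢M) a) (shift-o i a))
    where
    b⊔c≢M : b ⊔ c ≢ M
    b⊔c≢M e with ⊔-sel b c
    ... | inj₁ e′ = <⇒≢ b<M (trans (sym e′) e)
    ... | inj₂ e′ = c≢M (trans (sym e′) e)
  first : h 0 i θ (b ∷ M ∷ l) ≗ X i (θ (M ∷ b ∷ l))
  first a = cong₂ _+_ (vanish b _ a (<⇒≢ b<M))
    (cong₂ (λ x y → X i (θ (x ∷ y ∷ l)) a) (m≤n⇒m⊔n≡n (<⇒≤ b<M)) (m≤n⇒m⊓n≡m (<⇒≤ b<M)))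

downFrom : ∀ n → Vec ℕ n
downFrom zero = []
downFrom (suc n) = n ∷ downFrom n

ids-< : ∀ n {M} → n ≤ M → All (_< M) (ids n)
ids-< zero _ = []
ids-< (suc n) {M} n<M = snoc (ids-< n (<⇒≤ n<M))
  where
  snoc : ∀ {k} {l : Vec ℕ k} → All (_< M) l → All (_< M) (l ∷ʳ n)
  snoc [] = n<M ∷ []
  snoc (p ∷ ps) = p ∷ snoc ps

ind-oo : ∀ {o : A} (b a : Vec ℕ n) → ind o o b a ≡ o
ind-oo [] [] = refl
ind-oo (k ∷ b) (l ∷ a) with k ≡ᵇ l
... | true = ind-oo b a
... | false = refl

target-slice : ∀ c (w : Vec ℕ N) → slice {n = n} c 0 (target (c ∷ w)) ≐ target w
target-slice c w v a rewrite ≡ᵇ-refl c = refl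

target-slice-≢ : ∀ {b c} (w : Vec ℕ N) t → b ≢ c → ∀ v (a : Vec ℕ n) → slice b t (target (c ∷ w)) v a ≡ 0
target-slice-≢ {b = b} {c} w t b≢c v a = ind-≢ {b = c ∷ w} {b ∷ v} λ { refl → b≢c refl }

target-slice-suc : ∀ b (w : Vec ℕ (suc N)) t v (a : Vec ℕ n) → slice b (suc t) (target w) v a ≡ 0
target-slice-suc b w t v a = ind-oo w (b ∷ v)

ψ-downFrom : ∀ n → ψ (downFrom n) ≗ ind 0 1 (downFrom n)
ψ-downFrom zero [] = refl
ψ-downFrom (suc n) (t ∷ a) = begin
  Row-op 0 n 0 ρ (ids n ∷ʳ n) (t ∷ a)           ≡⟨ Row-op-max n 0 (ids-< n ≤-refl) vanish (t ∷ a) ⟩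
  iter n (X 0) (ρ (n ∷ ids n)) (t ∷ a)          ≡⟨ iter-X-cong n 0 start (t ∷ a) ⟩
  iter n (X 0) (ind 0 1 (0 ∷ downFrom n)) (t ∷ a) ≡⟨ iter-X-ind n 0 (t ∷ a) ⟩
  ind 0 1 (n + 0 ∷ downFrom n) (t ∷ a)          ≡⟨ cong (λ k → ind 0 1 (k ∷ downFrom n) (t ∷ a)) (+-identityʳ n) ⟩
  ind 0 1 (n ∷ downFrom n) (t ∷ a) ∎
  where
  open ≡-Reasoning
  ρ : Θ (suc n) (suc n)
  ρ = Rows 1 n (target (n ∷ downFrom n))
  vanish : ∀ b v a → b ≢ n → ρ (b ∷ v) a ≡ 0
  vanish b v (t ∷ a) b≢n = trans (Rows-slice 0 n _ b t v a)
    (linear-0 (Rows-linear 0 n) (target-slice-≢ (downFrom n) t b≢n) v a)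
  start : ρ (n ∷ ids n) ≗ ind 0 1 (0 ∷ downFrom n)
  start (zero ∷ a) = trans (Rows-slice 0 n _ n 0 (ids n) a)
    (trans (Rows-linear 0 n .≐-cong (target-slice n (downFrom n)) (ids n) a) (ψ-downFrom n a))
  start (suc t ∷ a) = trans (Rows-slice 0 n _ n (suc t) (ids n) a)
    (linear-0 (Rows-linear 0 n) (target-slice-suc n (n ∷ downFrom n) t) (ids n) a)
  iter-X-ind : ∀ k m → iter k (X 0) (ind 0 1 (m ∷ downFrom n)) ≗ ind 0 1 (k + m ∷ downFrom n)
  iter-X-ind zero m a = refl
  iter-X-ind (suc k) m a = trans (iter-X-cong k 0 (shift-ind 0 (m ∷ downFrom n) z<s) a)
    (trans (iter-X-ind k (suc m) a) (cong (λ z → ind 0 1 (z ∷ downFrom n) a) (+-suc k m)))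

-- Coefficients of Grothendieck polynomials

swapV≡swapAt : ∀ (j j′ : Fin n) (v : Vec A n) → toℕ j′ ≡ suc (toℕ j) → swapV j j′ v ≡ swapAt (toℕ j) v
swapV≡swapAt zero (suc zero) (x ∷ y ∷ v) e = cong (λ z → y ∷ x ∷ z) (tabulate∘lookup v)
swapV≡swapAt (suc j) (suc j′) (x ∷ v) e = cong (x ∷_) (trans tail-swapV (swapV≡swapAt j j′ v (suc-injective e)))
  where
  -- The two sides are inferred from tail-swapV: swapV's local function cannot be named here.
  pointwise : ∀ k → _ ≡ _
  tail-swapV : Vec.tail (swapV (suc j) (suc j′) (x ∷ v)) ≡ swapV j j′ v
  tail-swapV = tabulate-cong pointwise
  pointwise k with k Fin.≟ j | k Fin.≟ j′
  ... | yes _ | _ = refl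
  ... | no _ | yes _ = refl
  ... | no _ | no _ = refl

word : Perm n → Vec ℕ n
word = Vec.map toℕ

map-swapAt : ∀ {B : Set} (f : A → B) j (v : Vec A n) → Vec.map f (swapAt j v) ≡ swapAt j (Vec.map f v)
map-swapAt f zero [] = refl
map-swapAt f zero (_ ∷ []) = refl
map-swapAt f zero (_ ∷ _ ∷ _) = refl
map-swapAt f (suc j) [] = refl
map-swapAt f (suc j) (x ∷ v) = cong (f x ∷_) (map-swapAt f j v)

word-ascent : ∀ {k} (w : Vec (Fin k) n) (j j′ : Fin n) → toℕ j′ ≡ suc (toℕ j) → lookup w j Fin.< lookup w j′ →
              Ascent (toℕ j) (Vec.map toℕ w)
word-ascent (_ ∷ _ ∷ _) zero (suc zero) e lt = lt
word-ascent (_ ∷ w) (suc j) (suc j′) e lt = word-ascent w j j′ (suc-injective e) lt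

word-w₀ : ∀ n → word (w₀ {n}) ≡ downFrom n
word-w₀ zero = refl
word-w₀ (suc n) = cong₂ _∷_ (toℕ-fromℕ n) (trans (lower opposite) (word-w₀ n))
  where
  lower : ∀ {m k} (f : Fin m → Fin k) →
          Vec.map toℕ (tabulate (inject₁ ∘ f)) ≡ Vec.map toℕ (tabulate f)
  lower {zero} f = refl
  lower {suc m} f = cong₂ _∷_ (toℕ-inject₁ (f zero)) (lower (f ∘ suc))

staircase≡downFrom : ∀ n → tabulate (λ i → n ∸ suc (toℕ {n} i)) ≡ downFrom n
staircase≡downFrom zero = refl
staircase≡downFrom (suc n) = cong (n ∷_) (staircase≡downFrom n)

coeff-∷ : ∀ c (b : Vec ℕ n) p a → coeff ((c , b) ∷ p) a ≡ ind 0ℤ c b a ℤ.+ coeff p a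
coeff-∷ c b p a with ≡-dec ℕ._≟_ b a
... | yes refl = cong (ℤ._+ coeff p a) (sym (ind-refl b))
... | no b≢a = sym (trans (cong (ℤ._+ coeff p a) (ind-≢ b≢a)) (ℤ.+-identityˡ _))

coeff-++ : ∀ (p q : Poly n) a → coeff (p ++ q) a ≡ coeff p a ℤ.+ coeff q a
coeff-++ [] q a = sym (ℤ.+-identityˡ _)
coeff-++ ((c , b) ∷ p) q a = begin
  coeff ((c , b) ∷ p ++ q) a                     ≡⟨ coeff-∷ c b (p ++ q) a ⟩
  ind 0ℤ c b a ℤ.+ coeff (p ++ q) a              ≡⟨ cong (λ z → ind 0ℤ c b a ℤ.+ z) (coeff-++ p q a) ⟩
  ind 0ℤ c b a ℤ.+ (coeff p a ℤ.+ coeff q a)     ≡⟨ ℤ.+-assoc (ind 0ℤ c b a) _ _ ⟨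
  ind 0ℤ c b a ℤ.+ coeff p a ℤ.+ coeff q a       ≡⟨ cong (ℤ._+ coeff q a) (coeff-∷ c b p a) ⟨
  coeff ((c , b) ∷ p) a ℤ.+ coeff q a ∎
  where open ≡-Reasoning

ind-neg : ∀ c (b a : Vec ℕ n) → ind 0ℤ (ℤ.- c) b a ≡ ℤ.- ind 0ℤ c b a
ind-neg c [] [] = refl
ind-neg c (k ∷ b) (l ∷ a) with k ℕ.≡ᵇ l
... | true = ind-neg c b a
... | false = refl

ind-* : ∀ c d (b a : Vec ℕ n) → ind 0ℤ (c ℤ.* d) b a ≡ c ℤ.* ind 0ℤ d b a
ind-* c d [] [] = refl
ind-* c d (k ∷ b) (l ∷ a) with k ℕ.≡ᵇ l
... | true = ind-* c d b a
... | false = sym (ℤ.*-zeroʳ c)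

coeff-neg : ∀ (p : Poly n) a → coeff (-ₚ p) a ≡ ℤ.- coeff p a
coeff-neg [] a = refl
coeff-neg ((c , b) ∷ p) a = begin
  coeff (-ₚ ((c , b) ∷ p)) a                     ≡⟨ coeff-∷ (ℤ.- c) b (-ₚ p) a ⟩
  ind 0ℤ (ℤ.- c) b a ℤ.+ coeff (-ₚ p) a          ≡⟨ cong₂ ℤ._+_ (ind-neg c b a) (coeff-neg p a) ⟩
  ℤ.- ind 0ℤ c b a ℤ.+ ℤ.- coeff p a             ≡⟨ ℤ.neg-distrib-+ (ind 0ℤ c b a) _ ⟨
  ℤ.- (ind 0ℤ c b a ℤ.+ coeff p a)               ≡⟨ cong ℤ.-_ (coeff-∷ c b p a) ⟨
  ℤ.- coeff ((c , b) ∷ p) a ∎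
  where open ≡-Reasoning

coeff-- : ∀ (p q : Poly n) a → coeff (p -ₚ q) a ≡ coeff p a ℤ.- coeff q a
coeff-- p q a = trans (coeff-++ p (-ₚ q) a) (cong (λ z → coeff p a ℤ.+ z) (coeff-neg q a))

coeff-swapVars : ∀ (j j′ : Fin n) p a → toℕ j′ ≡ suc (toℕ j) →
                 coeff (swapVars j j′ p) a ≡ coeff p (swapAt (toℕ j) a)
coeff-swapVars j j′ [] a e = refl
coeff-swapVars j j′ ((c , b) ∷ p) a e = begin
  coeff (swapVars j j′ ((c , b) ∷ p)) a                          ≡⟨ coeff-∷ c (swapV j j′ b) (swapVars j j′ p) a ⟩
  ind 0ℤ c (swapV j j′ b) a ℤ.+ coeff (swapVars j j′ p) a        ≡⟨ cong₂ ℤ._+_ swap-ind (coeff-swapVars j j′ p a e) ⟩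
  ind 0ℤ c b (swapAt (toℕ j) a) ℤ.+ coeff p (swapAt (toℕ j) a)   ≡⟨ coeff-∷ c b p _ ⟨
  coeff ((c , b) ∷ p) (swapAt (toℕ j) a) ∎
  where
  open ≡-Reasoning
  swap-ind : ind 0ℤ c (swapV j j′ b) a ≡ ind 0ℤ c b (swapAt (toℕ j) a)
  swap-ind with ≡-dec ℕ._≟_ b (swapAt (toℕ j) a)
  ... | yes refl rewrite swapV≡swapAt j j′ (swapAt (toℕ j) a) e | swapAt-involutive (toℕ j) a
    = trans (ind-refl a) (sym (ind-refl (swapAt (toℕ j) a)))
  ... | no b≢sa = trans (ind-≢ sb≢a) (sym (ind-≢ b≢sa))
    where
    sb≢a : swapV j j′ b ≢ a
    sb≢a refl = b≢sa (sym (trans (cong (swapAt (toℕ j)) (swapV≡swapAt j j′ b e)) (swapAt-involutive (toℕ j) b)))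

*ₚ-∷ : ∀ c m (p q : Poly n) → ((c , m) ∷ p) *ₚ q ≡ (((c , m) ∷ []) *ₚ q) ++ (p *ₚ q)
*ₚ-∷ c m p q = cong (_++ (p *ₚ q)) (sym (++-identityʳ _))

-- S stands for multiplication by x^m on coefficient functions, given by its effect on the empty sum
-- and on a leading term; one induction then serves both 1 and the variables.
coeff-monomial : ∀ c (m : Vec ℕ n) (S : (Vec ℕ n → ℤ) → Vec ℕ n → ℤ) →
  (∀ a → S (λ _ → 0ℤ) a ≡ 0ℤ) →
  (∀ d b p a → S (coeff ((d , b) ∷ p)) a ≡ ind 0ℤ d (zipWith _+_ m b) a ℤ.+ S (coeff p) a) →
  ∀ q a → coeff (((c , m) ∷ []) *ₚ q) a ≡ c ℤ.* S (coeff q) a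
coeff-monomial c m S S-zero S-∷ [] a = sym (trans (cong (c ℤ.*_) (S-zero a)) (ℤ.*-zeroʳ c))
coeff-monomial c m S S-zero S-∷ ((d , b) ∷ q) a = begin
  coeff (((c , m) ∷ []) *ₚ ((d , b) ∷ q)) a
    ≡⟨ coeff-∷ (c ℤ.* d) (zipWith _+_ m b) (((c , m) ∷ []) *ₚ q) a ⟩
  ind 0ℤ (c ℤ.* d) (zipWith _+_ m b) a ℤ.+ coeff (((c , m) ∷ []) *ₚ q) a
    ≡⟨ cong₂ ℤ._+_ (ind-* c d (zipWith _+_ m b) a) (coeff-monomial c m S S-zero S-∷ q a) ⟩
  c ℤ.* ind 0ℤ d (zipWith _+_ m b) a ℤ.+ c ℤ.* S (coeff q) a
    ≡⟨ ℤ.*-distribˡ-+ c _ _ ⟨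
  c ℤ.* (ind 0ℤ d (zipWith _+_ m b) a ℤ.+ S (coeff q) a)
    ≡⟨ cong (c ℤ.*_) (S-∷ d b q a) ⟨
  c ℤ.* S (coeff ((d , b) ∷ q)) a ∎
  where open ≡-Reasoning

shift-+ : ∀ i (f g : Vec ℕ n → ℤ) a → shift 0ℤ i (λ b → f b ℤ.+ g b) a ≡ shift 0ℤ i f a ℤ.+ shift 0ℤ i g a
shift-+ i f g [] = refl
shift-+ zero f g (zero ∷ a) = refl
shift-+ zero f g (suc k ∷ a) = refl
shift-+ (suc i) f g (k ∷ a) = shift-+ i (f ∘ (k ∷_)) (g ∘ (k ∷_)) a

-- Read off from `var j`, whose exponent is tabulated from a local function that cannot be named
-- here.
varExp : Fin n → Vec ℕ n
varExp j = exponent (var j)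
  where
  exponent : Poly n → Vec ℕ n
  exponent [] = zeros
  exponent ((_ , m) ∷ _) = m

varExp-+ : ∀ (j : Fin n) b → zipWith _+_ (varExp j) b ≡ bump (toℕ j) b
varExp-+ zero (k ∷ b) = cong (suc k ∷_) (trans (cong (λ z → zipWith _+_ z b) (zero-tail _)) (zipWith-identityˡ (λ _ → refl) b))
  where
  zero-tail : ∀ n → tabulate {n = n} (λ _ → 0) ≡ zeros
  zero-tail zero = refl
  zero-tail (suc n) = cong (0 ∷_) (zero-tail n)
varExp-+ (suc j) (k ∷ b) = cong (k ∷_) (trans (cong (λ z → zipWith _+_ z b) tail-varExp) (varExp-+ j b))
  where
  pointwise : ∀ l → _ ≡ _
  tail-varExp : Vec.tail (varExp (suc j)) ≡ varExp j
  tail-varExp = tabulate-cong pointwise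
  pointwise l with l Fin.≟ j
  ... | yes _ = refl
  ... | no _ = refl

coeff-c·var : ∀ c (j : Fin n) q a →
  coeff (((c , varExp j) ∷ []) *ₚ q) a ≡ c ℤ.* shift 0ℤ (toℕ j) (coeff q) a
coeff-c·var c j = coeff-monomial c (varExp j) (shift 0ℤ (toℕ j)) (shift-o (toℕ j)) λ d b p a → begin
  shift 0ℤ (toℕ j) (coeff ((d , b) ∷ p)) a                          ≡⟨ shift-cong (toℕ j) (coeff-∷ d b p) a ⟩
  shift 0ℤ (toℕ j) (λ a → ind 0ℤ d b a ℤ.+ coeff p a) a             ≡⟨ shift-+ (toℕ j) (ind 0ℤ d b) (coeff p) a ⟩
  shift 0ℤ (toℕ j) (ind 0ℤ d b) a ℤ.+ shift 0ℤ (toℕ j) (coeff p) a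
    ≡⟨ cong (ℤ._+ shift 0ℤ (toℕ j) (coeff p) a) (trans (shift-ind (toℕ j) b (toℕ<n j) a)
         (cong (λ z → ind 0ℤ d z a) (sym (varExp-+ j b)))) ⟩
  ind 0ℤ d (zipWith _+_ (varExp j) b) a ℤ.+ shift 0ℤ (toℕ j) (coeff p) a ∎
  where
  open ≡-Reasoning

coeff-c·one : ∀ c q (a : Vec ℕ n) → coeff (((c , zeros) ∷ []) *ₚ q) a ≡ c ℤ.* coeff q a
coeff-c·one c = coeff-monomial c zeros (λ f → f) (λ _ → refl) λ d b p a →
  trans (coeff-∷ d b p a) (cong (λ z → ind 0ℤ d z a ℤ.+ coeff p a) (sym (zipWith-identityˡ (λ _ → refl) b)))

coeff-var-var : ∀ (j j′ : Fin n) q a → coeff ((var j -ₚ var j′) *ₚ q) a ≡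
                shift 0ℤ (toℕ j) (coeff q) a ℤ.- shift 0ℤ (toℕ j′) (coeff q) a
coeff-var-var j j′ q a = begin
  coeff ((var j -ₚ var j′) *ₚ q) a
    ≡⟨ cong (λ p → coeff p a) (*ₚ-∷ 1ℤ (varExp j) ((ℤ.- 1ℤ , varExp j′) ∷ []) q) ⟩
  coeff ((var j *ₚ q) ++ (((ℤ.- 1ℤ , varExp j′) ∷ []) *ₚ q)) a
    ≡⟨ coeff-++ (var j *ₚ q) _ a ⟩
  coeff (var j *ₚ q) a ℤ.+ coeff (((ℤ.- 1ℤ , varExp j′) ∷ []) *ₚ q) a
    ≡⟨ cong₂ ℤ._+_ (coeff-c·var 1ℤ j q a) (coeff-c·var (ℤ.- 1ℤ) j′ q a) ⟩
  1ℤ ℤ.* shift 0ℤ (toℕ j) (coeff q) a ℤ.+ ℤ.- 1ℤ ℤ.* shift 0ℤ (toℕ j′) (coeff q) a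
    ≡⟨ cong₂ ℤ._+_ (ℤ.*-identityˡ (shift 0ℤ (toℕ j) (coeff q) a)) (ℤ.-1*i≡-i (shift 0ℤ (toℕ j′) (coeff q) a)) ⟩
  shift 0ℤ (toℕ j) (coeff q) a ℤ.- shift 0ℤ (toℕ j′) (coeff q) a ∎
  where open ≡-Reasoning

coeff-one-var : ∀ (j : Fin n) q a → coeff ((oneₚ -ₚ var j) *ₚ q) a ≡ coeff q a ℤ.- shift 0ℤ (toℕ j) (coeff q) a
coeff-one-var j q a = begin
  coeff ((oneₚ -ₚ var j) *ₚ q) a
    ≡⟨ cong (λ p → coeff p a) (*ₚ-∷ 1ℤ zeros ((ℤ.- 1ℤ , varExp j) ∷ []) q) ⟩
  coeff ((oneₚ *ₚ q) ++ (((ℤ.- 1ℤ , varExp j) ∷ []) *ₚ q)) a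
    ≡⟨ coeff-++ (oneₚ *ₚ q) _ a ⟩
  coeff (oneₚ *ₚ q) a ℤ.+ coeff (((ℤ.- 1ℤ , varExp j) ∷ []) *ₚ q) a
    ≡⟨ cong₂ ℤ._+_ (coeff-c·one 1ℤ q a) (coeff-c·var (ℤ.- 1ℤ) j q a) ⟩
  1ℤ ℤ.* coeff q a ℤ.+ ℤ.- 1ℤ ℤ.* shift 0ℤ (toℕ j) (coeff q) a
    ≡⟨ cong₂ ℤ._+_ (ℤ.*-identityˡ (coeff q a)) (ℤ.-1*i≡-i (shift 0ℤ (toℕ j) (coeff q) a)) ⟩
  coeff q a ℤ.- shift 0ℤ (toℕ j) (coeff q) a ∎
  where open ≡-Reasoning

-- Induction on the exponent of x_{j+1}: the equation at (k + 1, l + 1) determines the value at (k,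
-- l + 1) from that at (k + 1, l), and at (k + 1, 0) the subtracted term is zero.
shift-difference-injective : ∀ j (f g : Vec ℕ n → ℤ) → suc j < n →
  (∀ a → shift 0ℤ j f a ℤ.- shift 0ℤ (suc j) f a ≡ shift 0ℤ j g a ℤ.- shift 0ℤ (suc j) g a) → f ≗ g
shift-difference-injective zero f g lt eq (_ ∷ []) = contradiction lt λ { (s≤s ()) }
shift-difference-injective zero f g lt eq (k ∷ l ∷ a) = go k l
  where
  cancel : ∀ x y {z t} → z ≡ t → x ℤ.- z ≡ y ℤ.- t → x ≡ y
  cancel x y {z} refl = ∙-cancelʳ (ℤ.- z) x y
  go : ∀ k l → f (k ∷ l ∷ a) ≡ g (k ∷ l ∷ a)
  go k zero = cancel (f (k ∷ zero ∷ a)) (g (k ∷ zero ∷ a)) {0ℤ} refl (eq (suc k ∷ zero ∷ a))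
  go k (suc l) = cancel (f (k ∷ suc l ∷ a)) (g (k ∷ suc l ∷ a)) (go (suc k) l) (eq (suc k ∷ suc l ∷ a))
shift-difference-injective (suc j) f g lt eq (k ∷ a) =
  shift-difference-injective j (f ∘ (k ∷_)) (g ∘ (k ∷_)) (s≤s⁻¹ lt) (eq ∘ (k ∷_)) a

alt : ℕ → ℤ
alt zero = 1ℤ
alt (suc k) = ℤ.- alt k

sgn : Vec ℕ n → ℤ
sgn [] = 1ℤ
sgn (k ∷ a) = alt k ℤ.* sgn a

sgn² : (a : Vec ℕ n) → sgn a ℤ.* sgn a ≡ 1ℤ
sgn² [] = refl
sgn² (k ∷ a) = trans (interchange (alt k) (sgn a)) (cong₂ ℤ._*_ (alt² k) (sgn² a))
  where
  alt² : ∀ k → alt k ℤ.* alt k ≡ 1ℤ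
  alt² zero = refl
  alt² (suc k) = trans (neg*neg (alt k)) (alt² k)
    where
    neg*neg : ∀ x → ℤ.- x ℤ.* ℤ.- x ≡ x ℤ.* x
    neg*neg = solveℤ-∀
  interchange : ∀ x y → x ℤ.* y ℤ.* (x ℤ.* y) ≡ x ℤ.* x ℤ.* (y ℤ.* y)
  interchange = solveℤ-∀

sgn-swapAt : ∀ j (a : Vec ℕ n) → sgn (swapAt j a) ≡ sgn a
sgn-swapAt zero [] = refl
sgn-swapAt zero (_ ∷ []) = refl
sgn-swapAt zero (k ∷ l ∷ a) = exchange (alt l) (alt k) (sgn a)
  where
  exchange : ∀ x y z → x ℤ.* (y ℤ.* z) ≡ y ℤ.* (x ℤ.* z)
  exchange = solveℤ-∀
sgn-swapAt (suc j) [] = refl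
sgn-swapAt (suc j) (k ∷ a) = cong (λ z → alt k ℤ.* z) (sgn-swapAt j a)

zero-right : ∀ ε s → 0ℤ ≡ ℤ.- ε ℤ.* (s ℤ.* 0ℤ)
zero-right = solveℤ-∀

-- The series ε f(-x₁, ..., -xₙ); this substitution turns the factor 1 - x_{j+1} of the recursion
-- into 1 + x_{j+1}.
signed : ℤ → Series n → Vec ℕ n → ℤ
signed ε f a = ε ℤ.* (sgn a ℤ.* + f a)

shift-signed : ∀ i ε (f : Series n) a → shift 0ℤ i (signed ε f) a ≡ signed (ℤ.- ε) (X i f) a
shift-signed i ε f [] = zero-right ε 1ℤ
shift-signed zero ε f (zero ∷ a) = zero-right ε (1ℤ ℤ.* sgn a)
shift-signed zero ε f (suc k ∷ a) = flip-sign ε (alt k) (sgn a) (+ f (k ∷ a))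
  where
  flip-sign : ∀ ε x s y → ε ℤ.* (x ℤ.* s ℤ.* y) ≡ ℤ.- ε ℤ.* (ℤ.- x ℤ.* s ℤ.* y)
  flip-sign = solveℤ-∀
shift-signed (suc i) ε f (k ∷ a) = trans
  (shift-cong i (λ b → factor ε (alt k) (sgn b) (+ f (k ∷ b))) a)
  (trans (shift-signed i (ε ℤ.* alt k) (f ∘ (k ∷_)) a)
    (unfactor ε (alt k) (sgn a) (+ X (suc i) f (k ∷ a))))
  where
  factor : ∀ ε x s y → ε ℤ.* (x ℤ.* s ℤ.* y) ≡ ε ℤ.* x ℤ.* (s ℤ.* y)
  factor = solveℤ-∀
  unfactor : ∀ ε x s y → ℤ.- (ε ℤ.* x) ℤ.* (s ℤ.* y) ≡ ℤ.- ε ℤ.* (x ℤ.* s ℤ.* y)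
  unfactor = solveℤ-∀

-- The sign ε is -1 to the number of inversions of w: it starts as the sign of the staircase
-- exponent and flips at each divided difference.
groth-ψ : ∀ {w : Perm n} {f} → IsGroth w f → ∃[ ε ] (ε ≢ 0ℤ × coeff f ≗ signed ε (ψ (word w)))
groth-ψ {n} (base {f} f≈xδ) = sgn δ , sgn≢0 , λ a → begin
  coeff f a                                      ≡⟨ f≈xδ a ⟩
  coeff xδ a                                     ≡⟨ coeff-∷ 1ℤ staircase [] a ⟩
  ind 0ℤ 1ℤ staircase a ℤ.+ 0ℤ                   ≡⟨ ℤ.+-identityʳ _ ⟩
  ind 0ℤ 1ℤ staircase a                          ≡⟨ cong (λ z → ind 0ℤ 1ℤ z a) (staircase≡downFrom n) ⟩
  ind 0ℤ 1ℤ δ a                                  ≡⟨ ind-signed a ⟩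
  sgn δ ℤ.* (sgn a ℤ.* + ind 0 1 δ a)            ≡⟨ cong (λ z → sgn δ ℤ.* (sgn a ℤ.* + z)) (ψ-downFrom n a) ⟨
  signed (sgn δ) (ψ δ) a                         ≡⟨ cong (λ z → signed (sgn δ) (ψ z) a) (word-w₀ n) ⟨
  signed (sgn δ) (ψ (word w₀)) a ∎
  where
  open ≡-Reasoning
  δ = downFrom n
  staircase = tabulate (λ i → n ∸ suc (toℕ {n} i))
  sgn≢0 : sgn δ ≢ 0ℤ
  sgn≢0 e with trans (sym (sgn² δ)) (cong (λ z → z ℤ.* sgn δ) e)
  ... | ()
  ind-signed : ∀ a → ind 0ℤ 1ℤ δ a ≡ sgn δ ℤ.* (sgn a ℤ.* + ind 0 1 δ a)
  ind-signed a with ≡-dec ℕ._≟_ δ a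
  ... | yes refl rewrite ind-refl {o = 0} {1} δ = trans (ind-refl δ)
    (trans (sym (sgn² δ)) (cong (λ z → sgn δ ℤ.* z) (sym (ℤ.*-identityʳ (sgn δ)))))
  ... | no δ≢a rewrite ind-≢ {o = 0} {1} δ≢a = trans (ind-≢ δ≢a)
    (sym (trans (cong (λ z → sgn δ ℤ.* z) (ℤ.*-zeroʳ (sgn a))) (ℤ.*-zeroʳ (sgn δ))))
groth-ψ {n} (step w j j′ f g j′≡1+j asc groth eq) with groth-ψ groth
... | ε , ε≢0 , f≗ = ℤ.- ε , ε≢0 ∘ ℤ.neg-injective , shift-difference-injective J (coeff g) _ 1+J<n quotient
  where
  open ≡-Reasoning
  J = toℕ j
  v = word w
  v′ = swapAt J v
  ascent : Ascent J v
  ascent = word-ascent w j j′ j′≡1+j asc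
  1+J<n = ascent-< J ascent
  f≗signed : coeff f ≗ signed ε (ψ v′)
  f≗signed a = trans (f≗ a) (cong (λ z → signed ε (ψ z) a)
    (trans (cong word (swapV≡swapAt j j′ w j′≡1+j)) (map-swapAt toℕ J w)))

  numerator : ∀ a → coeff ((oneₚ -ₚ var j′) *ₚ f) a ≡ ε ℤ.* (sgn a ℤ.* (+ ψ v′ a ℤ.+ + X (suc J) (ψ v′) a))
  numerator a = begin
    coeff ((oneₚ -ₚ var j′) *ₚ f) a
      ≡⟨ coeff-one-var j′ f a ⟩
    coeff f a ℤ.- shift 0ℤ (toℕ j′) (coeff f) a
      ≡⟨ cong₂ ℤ._-_ (f≗signed a) (shift-cong (toℕ j′) f≗signed a) ⟩
    signed ε (ψ v′) a ℤ.- shift 0ℤ (toℕ j′) (signed ε (ψ v′)) a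
      ≡⟨ cong (λ z → signed ε (ψ v′) a ℤ.- z) (shift-signed (toℕ j′) ε (ψ v′) a) ⟩
    signed ε (ψ v′) a ℤ.- signed (ℤ.- ε) (X (toℕ j′) (ψ v′)) a
      ≡⟨ collect ε (sgn a) (+ ψ v′ a) _ ⟩
    ε ℤ.* (sgn a ℤ.* (+ ψ v′ a ℤ.+ + X (toℕ j′) (ψ v′) a))
      ≡⟨ cong (λ z → ε ℤ.* (sgn a ℤ.* (+ ψ v′ a ℤ.+ + X z (ψ v′) a))) j′≡1+j ⟩
    ε ℤ.* (sgn a ℤ.* (+ ψ v′ a ℤ.+ + X (suc J) (ψ v′) a)) ∎
    where
    collect : ∀ ε s x y → ε ℤ.* (s ℤ.* x) ℤ.- ℤ.- ε ℤ.* (s ℤ.* y) ≡ ε ℤ.* (s ℤ.* (x ℤ.+ y))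
    collect = solveℤ-∀

  balance : ∀ a → let b = swapAt J a in
    (+ ψ v′ a ℤ.+ + X (suc J) (ψ v′) a) ℤ.- (+ ψ v′ b ℤ.+ + X (suc J) (ψ v′) b) ≡
    + X J (ψ v) a ℤ.- + X (suc J) (ψ v) a
  balance a = difference (ψ v′ b) (X (suc J) (ψ v′) b) (ψ v′ a) (X (suc J) (ψ v′) a) (X J (ψ v) a) (X (suc J) (ψ v) a) (cong +_ (begin
    ψ v′ b + (X J (ψ v) a + X (suc J) (ψ v′) b)
      ≡⟨ cong (λ z → ψ v′ b + (z + X (suc J) (ψ v′) b))
           (trans (shift-swap′ J (ψ v) 1+J<n a) (shift-cong J (ψ-ascent J v ascent) a)) ⟨
    ψ v′ b + (X (suc J) (ψ v) b + X (suc J) (ψ v′) b)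
      ≡⟨ cong (λ z → ψ v′ b + z) (X-⊕ (suc J) (ψ v) (ψ v′) b) ⟨
    ψ v′ b + X (suc J) (ψ v ⊕ ψ v′) b
      ≡⟨ ψ-descent J v ascent a ⟩
    ψ v′ a + X (suc J) (ψ v ⊕ ψ v′) a
      ≡⟨ cong (λ z → ψ v′ a + z) (X-⊕ (suc J) (ψ v) (ψ v′) a) ⟩
    ψ v′ a + (X (suc J) (ψ v) a + X (suc J) (ψ v′) a) ∎))
    where
    b = swapAt J a
    difference : ∀ p q r s x y → + (p + (x + q)) ≡ + (r + (y + s)) →
                 (+ r ℤ.+ + s) ℤ.- (+ p ℤ.+ + q) ≡ + x ℤ.- + y
    difference p q r s x y e = begin
      (+ r ℤ.+ + s) ℤ.- (+ p ℤ.+ + q)                                 ≡⟨ add-subtract (+ p) (+ q) (+ r) (+ s) (+ y) ⟩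
      + (r + (y + s)) ℤ.- (+ p ℤ.+ (+ y ℤ.+ + q))                     ≡⟨ cong (λ z → z ℤ.- (+ p ℤ.+ (+ y ℤ.+ + q))) e ⟨
      + (p + (x + q)) ℤ.- (+ p ℤ.+ (+ y ℤ.+ + q))                     ≡⟨ cancel (+ p) (+ q) (+ x) (+ y) ⟩
      + x ℤ.- + y ∎
      where
      add-subtract : ∀ p q r s y → (r ℤ.+ s) ℤ.- (p ℤ.+ q) ≡ (r ℤ.+ (y ℤ.+ s)) ℤ.- (p ℤ.+ (y ℤ.+ q))
      add-subtract = solveℤ-∀
      cancel : ∀ p q x y → (p ℤ.+ (x ℤ.+ q)) ℤ.- (p ℤ.+ (y ℤ.+ q)) ≡ x ℤ.- y
      cancel = solveℤ-∀

  g̃ = signed (ℤ.- ε) (ψ v)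

  quotient : ∀ a → shift 0ℤ J (coeff g) a ℤ.- shift 0ℤ (suc J) (coeff g) a ≡
                   shift 0ℤ J g̃ a ℤ.- shift 0ℤ (suc J) g̃ a
  quotient a = begin
    shift 0ℤ J (coeff g) a ℤ.- shift 0ℤ (suc J) (coeff g) a
      ≡⟨ cong (λ z → shift 0ℤ J (coeff g) a ℤ.- shift 0ℤ z (coeff g) a) j′≡1+j ⟨
    shift 0ℤ J (coeff g) a ℤ.- shift 0ℤ (toℕ j′) (coeff g) a
      ≡⟨ coeff-var-var j j′ g a ⟨
    coeff ((var j -ₚ var j′) *ₚ g) a
      ≡⟨ eq a ⟩
    coeff (H -ₚ swapVars j j′ H) a
      ≡⟨ coeff-- H (swapVars j j′ H) a ⟩
    coeff H a ℤ.- coeff (swapVars j j′ H) a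
      ≡⟨ cong (λ z → coeff H a ℤ.- z) (coeff-swapVars j j′ H a j′≡1+j) ⟩
    coeff H a ℤ.- coeff H b
      ≡⟨ cong₂ ℤ._-_ (numerator a) (trans (numerator b) (cong (λ z → ε ℤ.* (z ℤ.* (+ ψ v′ b ℤ.+ + X (suc J) (ψ v′) b))) (sgn-swapAt J a))) ⟩
    ε ℤ.* (sgn a ℤ.* (+ ψ v′ a ℤ.+ + X (suc J) (ψ v′) a)) ℤ.- ε ℤ.* (sgn a ℤ.* (+ ψ v′ b ℤ.+ + X (suc J) (ψ v′) b))
      ≡⟨ factor ε (sgn a) _ _ ⟩
    ε ℤ.* (sgn a ℤ.* ((+ ψ v′ a ℤ.+ + X (suc J) (ψ v′) a) ℤ.- (+ ψ v′ b ℤ.+ + X (suc J) (ψ v′) b)))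
      ≡⟨ cong (λ z → ε ℤ.* (sgn a ℤ.* z)) (balance a) ⟩
    ε ℤ.* (sgn a ℤ.* (+ X J (ψ v) a ℤ.- + X (suc J) (ψ v) a))
      ≡⟨ double-neg ε (sgn a) _ _ ⟩
    signed (ℤ.- (ℤ.- ε)) (X J (ψ v)) a ℤ.- signed (ℤ.- (ℤ.- ε)) (X (suc J) (ψ v)) a
      ≡⟨ cong₂ ℤ._-_ (shift-signed J (ℤ.- ε) (ψ v) a) (shift-signed (suc J) (ℤ.- ε) (ψ v) a) ⟨
    shift 0ℤ J g̃ a ℤ.- shift 0ℤ (suc J) g̃ a ∎
    where
    b = swapAt J a
    H = (oneₚ -ₚ var j′) *ₚ f
    factor : ∀ ε s x y → ε ℤ.* (s ℤ.* x) ℤ.- ε ℤ.* (s ℤ.* y) ≡ ε ℤ.* (s ℤ.* (x ℤ.- y))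
    factor = solveℤ-∀
    double-neg : ∀ ε s x y → ε ℤ.* (s ℤ.* (x ℤ.- y)) ≡ ℤ.- (ℤ.- ε) ℤ.* (s ℤ.* x) ℤ.- ℤ.- (ℤ.- ε) ℤ.* (s ℤ.* y)
    double-neg = solveℤ-∀

-- Subwords of the Fomin–Kirillov product

-- Row v v′ s: starting from v, an intermediate product of the factors 1 + x uⱼ of a row moves v to v′, using s of the uⱼ.
data Row : Vec ℕ (suc k) → Vec ℕ (suc k) → ℕ → Set where
  last : ∀ {b} → Row (b ∷ []) (b ∷ []) 0
  skip : ∀ {b s} {v v′ : Vec ℕ (suc k)} → Row v v′ s → Row (b ∷ v) (b ∷ v′) s
  take : ∀ {b s} {v v′ : Vec ℕ (suc k)} → Row v v′ s → Row (b ∷ v) (π 0 (b ∷ v′)) (suc s)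

-- After a row the front letter is out of reach of the remaining rows, so it is already the front
-- letter of the final word.
data Full : Vec ℕ n → Vec ℕ n → Vec ℕ n → Set where
  []  : Full [] [] []
  _∷_ : ∀ {b s} {v : Vec ℕ (suc n)} {v′ w a} → Row v (b ∷ v′) s → Full v′ w a → Full v (b ∷ w) (s ∷ a)

-- Each factor splits the coefficient into two summands, one of which is nonzero and can be
-- followed; `r` is the exponent of the first variable that the row leaves to θ.
row-support : ∀ k (v : Vec ℕ (suc k)) (θ : Θ (suc k) (suc n)) t a → Row-op 0 k 0 θ v (t ∷ a) ≢ 0 →
  ∃[ v′ ] ∃[ s ] ∃[ r ] (t ≡ s + r × Row v v′ s × θ v′ (r ∷ a) ≢ 0)
row-support zero v@(_ ∷ []) θ t a ≢0 = v , 0 , t , refl , last , ≢0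
row-support (suc k) (b ∷ v) θ t a ≢0
  with row-support k v (h 0 0 θ ∘ (b ∷_)) t a (≢0 ∘ trans (Row-op-cons 0 k 0 (h 0 0 θ) b v (t ∷ a)))
... | v′ , s , r , refl , row , h≢0 with θ (b ∷ v′) (r ∷ a) ℕ.≟ 0
...   | no θ≢0 = b ∷ v′ , s , r , refl , skip row , θ≢0
...   | yes θ≡0 with r
...     | zero = contradiction (cong₂ _+_ θ≡0 refl) h≢0
...     | suc r′ = π 0 (b ∷ v′) , suc s , r′ , +-suc s r′ , take row ,
                   λ πθ≡0 → h≢0 (cong₂ _+_ θ≡0 πθ≡0)

row-nonzero : ∀ {v v′ : Vec ℕ (suc k)} {s} → Row v v′ s → (θ : Θ (suc k) (suc n)) → ∀ r a →
              θ v′ (r ∷ a) ≢ 0 → Row-op 0 k 0 θ v (s + r ∷ a) ≢ 0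
row-nonzero last θ r a ≢0 = ≢0
row-nonzero {k = suc k} (skip {b = b} {s} {v} row) θ r a ≢0 e =
  row-nonzero row (h 0 0 θ ∘ (b ∷_)) r a (≢0 ∘ m+n≡0⇒m≡0 _)
    (trans (sym (Row-op-cons 0 k 0 (h 0 0 θ) b v (s + r ∷ a))) e)
row-nonzero {k = suc k} (take {b = b} {s} {v} {v′} row) θ r a ≢0 e =
  row-nonzero row (h 0 0 θ ∘ (b ∷_)) (suc r) a (≢0 ∘ m+n≡0⇒n≡0 (θ (b ∷ v′) (suc r ∷ a)))
    (trans (cong (λ z → Row-op 0 k 0 (h 0 0 θ ∘ (b ∷_)) v (z ∷ a)) (+-suc s r))
      (trans (sym (Row-op-cons 0 k 0 (h 0 0 θ) b v (suc s + r ∷ a))) e))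

full-nonzero : ∀ {v w a : Vec ℕ n} → Full v w a → Rows 0 n (target w) v a ≢ 0
full-nonzero [] = λ ()
full-nonzero {suc n} (_∷_ {b = b} {s} {v} {v′} {w} {a} row full) e =
  row-nonzero row (Rows 1 n (target (b ∷ w))) 0 a
    (λ ρ≡0 → full-nonzero full (trans (sym (trans (Rows-slice 0 n (target (b ∷ w)) b 0 v′ a)
       (Rows-linear 0 n .≐-cong (target-slice b w) v′ a))) ρ≡0))
    (trans (cong (λ z → Rows 0 (suc n) (target (b ∷ w)) v (z ∷ a)) (+-identityʳ s)) e)

full-support : ∀ (v w a : Vec ℕ n) → Rows 0 n (target w) v a ≢ 0 → Full v w a
full-support [] [] [] _ = []
full-support {suc n} v (c ∷ w) (t ∷ a) ≢0
  with row-support n v (Rows 1 n (target (c ∷ w))) t a ≢0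
-- The later rows never use the first variable, so no exponent may be left over.
... | b ∷ v′ , s , suc r , refl , row , ρ≢0 =
  contradiction (trans (Rows-slice 0 n (target (c ∷ w)) b (suc r) v′ a)
    (linear-0 (Rows-linear 0 n) (target-slice-suc b (c ∷ w) r) v′ a)) ρ≢0
... | b ∷ v′ , s , zero , refl , row , ρ≢0 with b ℕ.≟ c
...   | no b≢c = contradiction (trans (Rows-slice 0 n (target (c ∷ w)) b 0 v′ a)
          (linear-0 (Rows-linear 0 n) (target-slice-≢ w 0 b≢c) v′ a)) ρ≢0
...   | yes refl = subst (λ z → Full v (b ∷ w) (z ∷ a)) (sym (+-identityʳ s))
          (row ∷ full-support v′ w a λ ≡0 → ρ≢0 (trans (Rows-slice 0 n (target (b ∷ w)) b 0 v′ a)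
            (trans (Rows-linear 0 n .≐-cong (target-slice b w) v′ a) ≡0)))

-- Upper bound for exponents by non-records

nonRecords : ℕ → Vec ℕ n → ℕ
nonRecords m [] = 0
nonRecords m (b ∷ l) with m ℕ.<? b
... | yes _ = nonRecords b l
... | no _ = suc (nonRecords m l)

nonRecords-< : ∀ {m b} (l : Vec ℕ n) → m < b → nonRecords m (b ∷ l) ≡ nonRecords b l
nonRecords-< {m = m} {b} l lt with m ℕ.<? b
... | yes _ = refl
... | no ≮ = contradiction lt ≮

nonRecords-≥ : ∀ {m b} (l : Vec ℕ n) → b ≤ m → nonRecords m (b ∷ l) ≡ suc (nonRecords m l)
nonRecords-≥ {m = m} {b} l le with m ℕ.<? b
... | yes lt = contradiction le (<⇒≱ lt)
... | no _ = refl

nonRecords-mono : ∀ {m m′} (l : Vec ℕ n) → m ≤ m′ → nonRecords m l ≤ nonRecords m′ l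
nonRecords-mono [] le = z≤n
nonRecords-mono {m = m} {m′} (b ∷ l) le with m ℕ.<? b | m′ ℕ.<? b
... | yes _ | yes _ = ≤-refl
... | yes _ | no m′≮b = m≤n⇒m≤1+n (nonRecords-mono l (≮⇒≥ m′≮b))
... | no m≮b | yes m′<b = contradiction (≤-<-trans le m′<b) m≮b
... | no _ | no _ = s≤s (nonRecords-mono l le)

nonRecords-∷ : ∀ {v v′ : Vec ℕ n} → (∀ m → nonRecords m v ≤ nonRecords m v′) →
               ∀ b m → nonRecords m (b ∷ v) ≤ nonRecords m (b ∷ v′)
nonRecords-∷ mono b m with m ℕ.<? b
... | yes _ = mono b
... | no _ = s≤s (mono m)

-- When a < b are exchanged, a behind b is certainly not a record, and the letters further on meet
-- the same running maximum as before.
nonRecords-π : ∀ m (v : Vec ℕ n) → nonRecords m v ≤ nonRecords m (π 0 v)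
nonRecords-π m [] = ≤-refl
nonRecords-π m (_ ∷ []) = ≤-refl
nonRecords-π m (a ∷ b ∷ v) with ≤-total b a
... | inj₁ b≤a rewrite m≥n⇒m⊔n≡m b≤a | m≥n⇒m⊓n≡n b≤a = ≤-refl
... | inj₂ a≤b rewrite m≤n⇒m⊔n≡n a≤b | m≤n⇒m⊓n≡m a≤b with m ℕ.<? b
...   | yes m<b = subst₂ _≤_ refl (sym (nonRecords-≥ v a≤b)) drop-a
  where
  drop-a : nonRecords m (a ∷ b ∷ v) ≤ suc (nonRecords b v)
  drop-a with m ℕ.<? a
  ... | no _ = s≤s (≤-reflexive (nonRecords-< v m<b))
  ... | yes _ with a ℕ.<? b
  ...   | yes _ = n≤1+n _
  ...   | no _ = s≤s (nonRecords-mono v a≤b)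
...   | no m≮b rewrite nonRecords-≥ (b ∷ v) (≤-trans a≤b (≮⇒≥ m≮b)) | nonRecords-≥ v (≮⇒≥ m≮b)
                     | nonRecords-≥ v (≤-trans a≤b (≮⇒≥ m≮b)) = ≤-refl

row-nonRecords : ∀ {v v′ : Vec ℕ (suc k)} {s} → Row v v′ s → ∀ m → nonRecords m v ≤ nonRecords m v′
row-nonRecords last m = ≤-refl
row-nonRecords (skip {b = b} row) = nonRecords-∷ (row-nonRecords row) b
row-nonRecords (take {b = b} {v′ = v′} row) m =
  ≤-trans (nonRecords-∷ (row-nonRecords row) b m) (nonRecords-π m (b ∷ v′))

full-nonRecords : ∀ {v w a : Vec ℕ n} → Full v w a → ∀ m → nonRecords m v ≤ nonRecords m w
full-nonRecords [] m = ≤-refl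
full-nonRecords (_∷_ {b = b} row full) m = ≤-trans (row-nonRecords row m) (nonRecords-∷ (full-nonRecords full) b m)

-- A taken factor puts the smaller of two letters right behind the larger, which adds a non-record;
-- those further back remain, because the maximum before them never drops.
row-bound : ∀ {b s} {v : Vec ℕ (suc k)} {v′} → Row v (b ∷ v′) s → s ≤ nonRecords b v′
row-bound row = go row
  where
  -- The final word must be a variable: the index of `take` is a stuck `π 0` and does not unify with
  -- a cons.
  go : ∀ {k s} {v v′ : Vec ℕ (suc k)} → Row v v′ s → s ≤ nonRecords (Vec.head v′) (Vec.tail v′)
  go last = z≤n
  go (skip {b = b} {v′ = c ∷ l} row) with b ℕ.<? c
  ... | yes _ = go row
  ... | no b≮c = m≤n⇒m≤1+n (≤-trans (go row) (nonRecords-mono l (≮⇒≥ b≮c)))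
  go (take {b = b} {v′ = c ∷ l} row) = subst (_ ≤_) (sym (nonRecords-≥ l (m⊓n≤m⊔n b c)))
    (s≤s (≤-trans (go row) (nonRecords-mono l (m≤n⊔m b c))))

nonRecordVec : Vec ℕ n → Vec ℕ n
nonRecordVec [] = []
nonRecordVec (b ∷ w) = nonRecords b w ∷ nonRecordVec w

full-bound : ∀ {v w a : Vec ℕ n} → Full v w a → Pointwise _≤_ a (nonRecordVec w)
full-bound [] = []
full-bound (_∷_ {b = b} row full) = ≤-trans (row-bound row) (full-nonRecords full b) ∷ full-bound full

-- Lower bound: the greedy subword

data Before : Vec ℕ n → ℕ → ℕ → Set where
  here : ∀ {a b} {w : Vec ℕ n} → b ∈ w → Before (a ∷ w) a b
  there : ∀ {a b c} {w : Vec ℕ n} → Before w a b → Before (c ∷ w) a b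

before-∈ : ∀ {w : Vec ℕ n} {a b} → Before w a b → a ∈ w × b ∈ w
before-∈ (here b∈w) = here refl , there b∈w
before-∈ (there bef) = there (proj₁ (before-∈ bef)) , there (proj₂ (before-∈ bef))

before-total : ∀ {w : Vec ℕ n} {a b} → a ∈ w → b ∈ w → a ≢ b → Before w a b ⊎ Before w b a
before-total (here refl) (here refl) a≢b = contradiction refl a≢b
before-total (here refl) (there b∈w) a≢b = inj₁ (here b∈w)
before-total (there a∈w) (here refl) a≢b = inj₂ (here a∈w)
before-total (there a∈w) (there b∈w) a≢b with before-total a∈w b∈w a≢b
... | inj₁ bef = inj₁ (there bef)
... | inj₂ bef = inj₂ (there bef)

Distinct : Vec ℕ n → Set
Distinct = AllPairs _≢_

head∉ : ∀ {x} {w : Vec ℕ n} → All (x ≢_) w → ¬ x ∈ w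
head∉ (x≢y ∷ _) (here x≡y) = x≢y x≡y
head∉ (_ ∷ x≢) (there x∈w) = head∉ x≢ x∈w

head-first : ∀ {x b} {w : Vec ℕ n} → Distinct (x ∷ w) → ¬ Before (x ∷ w) b x
head-first (x≢ ∷ _) (here x∈w) = head∉ x≢ x∈w
head-first (x≢ ∷ _) (there bef) = head∉ x≢ (proj₂ (before-∈ bef))

before-asym : ∀ {a b} {w : Vec ℕ n} → Distinct w → Before w a b → ¬ Before w b a
before-asym (x≢ ∷ _) (here b∈w) (here _) = head∉ x≢ b∈w
before-asym (x≢ ∷ _) (here _) (there bef) = head∉ x≢ (proj₂ (before-∈ bef))
before-asym (x≢ ∷ _) (there bef) (here _) = head∉ x≢ (proj₂ (before-∈ bef))
before-asym (_ ∷ distinct) (there bef) (there bef′) = before-asym distinct bef bef′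

ascents : ℕ → Vec ℕ n → ℕ
ascents x [] = 0
ascents x (y ∷ w) with x ℕ.<? y
... | yes _ = suc (ascents y w)
... | no _ = ascents y w

ascentsFrom : Vec ℕ n → ℕ → ℕ
ascentsFrom [] b = 0
ascentsFrom (x ∷ w) b with b ℕ.≟ x
... | yes _ = ascents x w
... | no _ = ascentsFrom w b

ascentsFrom-head : ∀ x (w : Vec ℕ n) → ascentsFrom (x ∷ w) x ≡ ascents x w
ascentsFrom-head x w with x ℕ.≟ x
... | yes _ = refl
... | no x≢x = contradiction refl x≢x

ascentsFrom-tail : ∀ {x b} {w : Vec ℕ n} → b ≢ x → ascentsFrom (x ∷ w) b ≡ ascentsFrom w b
ascentsFrom-tail {x = x} {b} b≢x with b ℕ.≟ x
... | yes b≡x = contradiction b≡x b≢x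
... | no _ = refl

ascents-∷ : ∀ x y (w : Vec ℕ n) → ascents y w ≤ ascents x (y ∷ w)
ascents-∷ x y w with x ℕ.<? y
... | yes _ = n≤1+n _
... | no _ = ≤-refl

ascentsFrom-≤ : ∀ x b (w : Vec ℕ n) → ascentsFrom w b ≤ ascents x w
ascentsFrom-≤ x b [] = z≤n
ascentsFrom-≤ x b (y ∷ w) with b ℕ.≟ y
... | yes _ = ascents-∷ x y w
... | no _ = ≤-trans (ascentsFrom-≤ y b w) (ascents-∷ x y w)

-- A word that gets from x to a larger letter b rises somewhere on the way.
ascentsFrom-< : ∀ {x b} {w : Vec ℕ n} → b ∈ w → x < b → ascentsFrom w b < ascents x w
ascentsFrom-< {x = x} {b} {y ∷ w} b∈ x<b with b ℕ.≟ y
... | yes refl with x ℕ.<? b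
...   | yes _ = ≤-refl
...   | no x≮b = contradiction x<b x≮b
ascentsFrom-< {x = x} {b} {y ∷ w} (here b≡y) x<b | no b≢y = contradiction b≡y b≢y
ascentsFrom-< {x = x} {b} {y ∷ w} (there b∈w) x<b | no b≢y with x ℕ.<? y
... | yes _ = s≤s (ascentsFrom-≤ y b w)
... | no x≮y = ascentsFrom-< b∈w (≤-<-trans (≮⇒≥ x≮y) x<b)

before-ascentsFrom : ∀ {a b} {w : Vec ℕ n} → Distinct w → Before w a b →
  ascentsFrom w b ≤ ascentsFrom w a × (a < b → ascentsFrom w b < ascentsFrom w a)
before-ascentsFrom {a = a} {b} {_ ∷ w} (a≢ ∷ _) (here b∈w)
  rewrite ascentsFrom-head a w | ascentsFrom-tail {w = w} (λ b≡a → head∉ a≢ (subst (_∈ w) b≡a b∈w))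
  = ascentsFrom-≤ a b w , ascentsFrom-< b∈w
before-ascentsFrom {a = a} {b} {x ∷ w} (x≢ ∷ distinct) (there bef)
  rewrite ascentsFrom-tail {w = w} (λ a≡x → head∉ x≢ (subst (_∈ w) a≡x (proj₁ (before-∈ bef))))
        | ascentsFrom-tail {w = w} (λ b≡x → head∉ x≢ (subst (_∈ w) b≡x (proj₂ (before-∈ bef))))
  = before-ascentsFrom distinct bef

-- AllPairs (Compatible w) v says that v lies below w in the weak order: every inversion of v is an inversion of w.
Compatible : Vec ℕ n → ℕ → ℕ → Set
Compatible w a b = a ≢ b × (b < a → Before w a b)

π-All : ∀ {P : ℕ → Set} (v : Vec ℕ n) → All P v → All P (π 0 v)
π-All [] ps = ps
π-All (_ ∷ []) ps = ps
π-All (a ∷ b ∷ v) (pa ∷ pb ∷ ps) with ≤-total a b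
... | inj₁ a≤b rewrite m≤n⇒m⊔n≡n a≤b | m≤n⇒m⊓n≡m a≤b = pb ∷ pa ∷ ps
... | inj₂ b≤a rewrite m≥n⇒m⊔n≡m b≤a | m≥n⇒m⊓n≡n b≤a = pa ∷ pb ∷ ps

row-All : ∀ {P : ℕ → Set} {v v′ : Vec ℕ (suc k)} {s} → Row v v′ s → All P v → All P v′
row-All last ps = ps
row-All (skip row) (p ∷ ps) = p ∷ row-All row ps
row-All (take {b = b} {v′ = v′} row) (p ∷ ps) = π-All (b ∷ v′) (p ∷ row-All row ps)

π-∈ : ∀ {c} (v : Vec ℕ n) → c ∈ v → c ∈ π 0 v
π-∈ (_ ∷ []) c∈ = c∈
π-∈ (a ∷ b ∷ v) c∈ with ≤-total a b
π-∈ (a ∷ b ∷ v) c∈ | inj₂ b≤a rewrite m≥n⇒m⊔n≡m b≤a | m≥n⇒m⊓n≡n b≤a = c∈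
π-∈ (a ∷ b ∷ v) (here refl) | inj₁ a≤b rewrite m≤n⇒m⊔n≡n a≤b | m≤n⇒m⊓n≡m a≤b = there (here refl)
π-∈ (a ∷ b ∷ v) (there (here refl)) | inj₁ a≤b rewrite m≤n⇒m⊔n≡n a≤b = here refl
π-∈ (a ∷ b ∷ v) (there (there c∈)) | inj₁ a≤b = there (there c∈)

row-∈ : ∀ {c} {v v′ : Vec ℕ (suc k)} {s} → Row v v′ s → c ∈ v → c ∈ v′
row-∈ last c∈ = c∈
row-∈ (skip row) (here e) = here e
row-∈ (skip row) (there c∈) = there (row-∈ row c∈)
row-∈ (take {b = b} {v′ = v′} row) (here e) = π-∈ (b ∷ v′) (here e)
row-∈ (take {b = b} {v′ = v′} row) (there c∈) = π-∈ (b ∷ v′) (there (row-∈ row c∈))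

take-≤ : ∀ {a b s} {v : Vec ℕ (suc k)} {v′} → Row v (b ∷ v′) s → a ≤ b → Row (a ∷ v) (b ∷ a ∷ v′) (suc s)
take-≤ {a = a} {b} {v′ = v′} row a≤b = subst₂ (λ x y → Row (a ∷ _) (x ∷ y ∷ v′) _)
  (m≤n⇒m⊔n≡n a≤b) (m≤n⇒m⊓n≡m a≤b) (take row)

take-≥ : ∀ {a b s} {v : Vec ℕ (suc k)} {v′} → Row v (b ∷ v′) s → b ≤ a → Row (a ∷ v) (a ∷ b ∷ v′) (suc s)
take-≥ {a = a} {b} {v′ = v′} row b≤a = subst₂ (λ x y → Row (a ∷ _) (x ∷ y ∷ v′) _)
  (m≥n⇒m⊔n≡m b≤a) (m≥n⇒m⊓n≡n b≤a) (take row)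

-- Take every uⱼ that does not create an inversion outside x ∷ w. Then the front entry is always the one that comes first
-- in x ∷ w, and each skipped uⱼ is paid for by an ascent of x ∷ w.
greedy-row : ∀ {x} {w : Vec ℕ m} (v : Vec ℕ (suc k)) → Distinct (x ∷ w) → All (_∈ (x ∷ w)) v →
  AllPairs (Compatible (x ∷ w)) v →
  ∃[ b ] ∃[ v′ ] ∃[ s ] (Row v (b ∷ v′) s × AllPairs (Compatible (x ∷ w)) (b ∷ v′) ×
    k ≤ s + ascentsFrom (x ∷ w) b × (x ∈ v → b ≡ x))
greedy-row (b ∷ []) distinct ⊆w compat = b , [] , 0 , last , compat , z≤n , λ { (here x≡b) → sym x≡b }
greedy-row {k = suc k} {x} {w} (a ∷ v) distinct (a∈w ∷ ⊆w) (a-compat ∷ compat)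
  with greedy-row v distinct ⊆w compat
... | b , v′ , s , row , compat′@(b-compat ∷ v′-compat) , bound , first
  with row-All row a-compat | row-All row ⊆w
... | ab@(a≢b , inv) ∷ a-compat′ | b∈w ∷ _ with before-total a∈w b∈w a≢b
...   | inj₂ b-before-a = b , a ∷ v′ , suc s , take-≤ row (≮⇒≥ b≮a) ,
        ((a≢b ∘ sym , λ _ → b-before-a) ∷ b-compat) ∷ a-compat′ ∷ v′-compat , s≤s bound ,
        λ { (here refl) → contradiction b-before-a (head-first distinct) ; (there x∈v) → first x∈v }
  where
  b≮a : ¬ b < a
  b≮a b<a = before-asym distinct (inv b<a) b-before-a
...   | inj₁ a-before-b with before-ascentsFrom distinct a-before-b | a ℕ.<? b
-- Taking the factor would put b before a, an inversion that `x ∷ w` lacks; its rise between a and b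
-- pays for the skip.
...     | _ , asc< | yes a<b = a , b ∷ v′ , s , skip row , (ab ∷ a-compat′) ∷ compat′ ,
          ≤-trans (s≤s bound) (≤-trans (≤-reflexive (sym (+-suc s _))) (+-monoʳ-≤ s (asc< a<b))) ,
          λ { (here refl) → refl
            ; (there x∈v) → contradiction (subst (Before _ a) (first x∈v) a-before-b) (head-first distinct) }
-- The pair is already decreasing, so the factor adds to the exponent without moving the word.
...     | asc≤ , _ | no a≮b = a , b ∷ v′ , suc s , take-≥ row (≮⇒≥ a≮b) , (ab ∷ a-compat′) ∷ compat′ ,
          s≤s (≤-trans bound (+-monoʳ-≤ s asc≤)) ,
          λ { (here refl) → refl
            ; (there x∈v) → contradiction (subst (Before _ a) (first x∈v) a-before-b) (head-first distinct) }

-- Each record behind x is the top of an ascent. The inequality says the converse, that each ascent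
-- top of `x ∷ w` is a record; in this form the fireworks condition enters the greedy construction.
RecordAscents : Vec ℕ n → Set
RecordAscents [] = ⊤
RecordAscents {suc n} (x ∷ w) = nonRecords x w + ascents x w ≤ n × RecordAscents w

compatible-tail : ∀ {x} {w : Vec ℕ m} {v : Vec ℕ n} → All (Compatible (x ∷ w) x) v →
  AllPairs (Compatible (x ∷ w)) v → AllPairs (Compatible w) v
compatible-tail [] [] = []
compatible-tail {x = x} {w} ((x≢a , _) ∷ x-compat) (a-compat ∷ compat) =
  All.map (λ { (a≢b , inv) → a≢b , λ b<a → tail (inv b<a) }) a-compat ∷ compatible-tail x-compat compat
  where
  tail : ∀ {b} → Before (x ∷ w) _ b → Before w _ b
  tail (here _) = contradiction refl x≢a
  tail (there bef) = bef

-- In each row non-records plus ascents are at most the number of factors, which is at most the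
-- factors taken plus ascents; the ascents cancel.
greedy : ∀ (w v : Vec ℕ n) → Distinct w → RecordAscents w → All (_∈ w) v → All (_∈ v) w →
  AllPairs (Compatible w) v → ∃[ a ] (Full v w a × Pointwise _≤_ (nonRecordVec w) a)
greedy [] [] _ _ _ _ _ = [] , [] , []
greedy (x ∷ w) v distinct@(x≢ ∷ distinct-w) (records , rest) v⊆w (x∈v ∷ w⊆v) compat
  with greedy-row v distinct v⊆w compat
... | b , v′ , s , row , b-compat ∷ compat′ , bound , first with first x∈v
...   | refl with greedy w v′ distinct-w rest v′⊆w w⊆v′ (compatible-tail b-compat compat′)
  where
  v′⊆w : All (_∈ w) v′
  v′⊆w with row-All row v⊆w
  ... | _ ∷ v′⊆xw = All.map (λ { ((x≢c , _) , here refl) → contradiction refl x≢c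
                                   ; (_ , there c∈w) → c∈w }) (All.zip (b-compat , v′⊆xw))
  w⊆v′ : All (_∈ v′) w
  w⊆v′ = All.map (λ { (x≢c , c∈v) → tail x≢c (row-∈ row c∈v) }) (All.zip (x≢ , w⊆v))
    where
    tail : ∀ {c} → x ≢ c → c ∈ (x ∷ v′) → c ∈ v′
    tail x≢c (here refl) = contradiction refl x≢c
    tail _ (there c∈) = c∈
...     | a , full , le = s ∷ a , row ∷ full ,
          +-cancelʳ-≤ (ascents x w) _ _ (≤-trans records
            (≤-trans bound (≤-reflexive (cong (λ z → s + z) (ascentsFrom-head x w))))) ∷ le

-- Fireworks permutations and the Rothe diagram

-- The word x ∷ l continues a word whose current decreasing run starts with m.
data Continues : ℕ → ℕ → Vec ℕ n → Set where
  end  : ∀ {m x} → Continues m x []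
  rise : ∀ {m x b} {l : Vec ℕ n} → x < b → m < b → Continues b b l → Continues m x (b ∷ l)
  fall : ∀ {m x b} {l : Vec ℕ n} → b ≤ x → Continues m b l → Continues m x (b ∷ l)

-- Each letter counts exactly once: a falling letter is at most the running maximum m, and a rising
-- one starts a run, so it exceeds m₀ and hence m. The two differ for suffixes that begin inside a
-- run, where the maximum may be below the start of the run.
continues-bound : ∀ {m₀ m x} {l : Vec ℕ n} → Continues m₀ x l → m ≤ m₀ → x ≤ m →
                  nonRecords m l + ascents x l ≤ n
continues-bound end _ _ = z≤n
continues-bound {m₀ = m₀} {m} {x} {b ∷ l} (rise x<b m₀<b c) m≤m₀ _ with m ℕ.<? b | x ℕ.<? b
... | no m≮b | _ = contradiction (≤-<-trans m≤m₀ m₀<b) m≮b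
... | yes _ | no x≮b = contradiction x<b x≮b
... | yes _ | yes _ = ≤-trans (≤-reflexive (+-suc (nonRecords b l) _)) (s≤s (continues-bound c ≤-refl ≤-refl))
continues-bound {m₀ = m₀} {m} {x} {b ∷ l} (fall b≤x c) m≤m₀ x≤m with m ℕ.<? b | x ℕ.<? b
... | yes m<b | _ = contradiction (≤-trans b≤x x≤m) (<⇒≱ m<b)
... | no _ | yes x<b = contradiction b≤x (<⇒≱ x<b)
... | no _ | no _ = s≤s (continues-bound c m≤m₀ (≤-trans b≤x x≤m))

continues-recordAscents : ∀ {m x} {l : Vec ℕ n} → Continues m x l → x ≤ m → RecordAscents l
continues-recordAscents end _ = tt
continues-recordAscents (rise _ _ c) _ = continues-bound c ≤-refl ≤-refl , continues-recordAscents c ≤-refl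
continues-recordAscents (fall b≤x c) x≤m =
  continues-bound c (≤-trans b≤x x≤m) ≤-refl , continues-recordAscents c (≤-trans b≤x x≤m)

fireworks-continues : ∀ (m x : Fin N) (l : Vec (Fin N) k) →
  let Rise = λ i → lookup (x ∷ l) (inject₁ i) Fin.< lookup l i in
  (∀ i → Rise i → m Fin.< lookup l i) →
  (∀ i i′ → i Fin.< i′ → Rise i → Rise i′ → lookup l i Fin.< lookup l i′) →
  Continues (toℕ m) (toℕ x) (Vec.map toℕ l)
fireworks-continues m x [] above increasing = end
fireworks-continues m x (b ∷ l) above increasing with x Fin.<? b
... | yes x<b = rise x<b (above zero x<b) (fireworks-continues b b l
      (λ i r → increasing zero (suc i) (s≤s z≤n) x<b r)
      (λ i i′ lt → increasing (suc i) (suc i′) (s≤s lt)))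
... | no x≮b = fall (≮⇒≥ x≮b) (fireworks-continues m b l (above ∘ suc)
      (λ i i′ lt → increasing (suc i) (suc i′) (s≤s lt)))

fireworks-recordAscents : ∀ (w : Perm n) → Fireworks w → RecordAscents (word w)
fireworks-recordAscents [] fw = tt
fireworks-recordAscents {suc n} (x ∷ l) fw = continues-bound cont ≤-refl ≤-refl , continues-recordAscents cont ≤-refl
  where
  start : ∀ i → lookup (x ∷ l) (inject₁ i) Fin.< lookup l i → IsRunStart (x ∷ l) (suc i)
  start i r = inj₂ (inject₁ i , cong suc (sym (toℕ-inject₁ i)) , r)
  cont = fireworks-continues x x l
    (λ i r → fw zero (suc i) (inj₁ refl) (start i r) (s≤s z≤n))
    (λ i i′ lt r r′ → fw (suc i) (suc i′) (start i r) (start i′ r′) (s≤s lt))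

injective⇒surjective : (f : Fin n → Fin n) → (∀ i k → f i ≡ f k → i ≡ k) → ∀ j → ∃[ i ] f i ≡ j
injective⇒surjective {suc n} f f-inj j with any? (λ i → f i Fin.≟ j)
... | yes found = found
... | no avoids = contradiction
  (injective⇒≤ {f = λ i → punchOut (j≢f i)} (λ {i} {k} e → f-inj i k (punchOut-injective (j≢f i) (j≢f k) e))) 1+n≰n
  where
  j≢f : ∀ i → j ≢ f i
  j≢f i j≡fi = avoids (i , sym j≡fi)

ids-increasing : ∀ n → AllPairs _<_ (ids n)
ids-increasing zero = []
ids-increasing (suc n) = snoc (ids-< n ≤-refl) (ids-increasing n)
  where
  all-snoc : ∀ {k x M} {l : Vec ℕ k} → x < M → All (x <_) l → All (x <_) (l ∷ʳ M)
  all-snoc x<M [] = x<M ∷ []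
  all-snoc x<M (p ∷ ps) = p ∷ all-snoc x<M ps
  snoc : ∀ {k M} {l : Vec ℕ k} → All (_< M) l → AllPairs _<_ l → AllPairs _<_ (l ∷ʳ M)
  snoc [] [] = [] ∷ []
  snoc (x<M ∷ l<M) (x<l ∷ inc) = all-snoc x<M x<l ∷ snoc l<M inc

∈-ids : ∀ {i} n → i < n → i ∈ ids n
∈-ids {i} (suc n) i<1+n with i ℕ.≟ n
... | yes refl = last-∈ (ids n)
  where
  last-∈ : ∀ {k} (l : Vec ℕ k) → i ∈ (l ∷ʳ i)
  last-∈ [] = here refl
  last-∈ (_ ∷ l) = there (last-∈ l)
... | no i≢n = snoc-∈ (∈-ids n (≤∧≢⇒< (s≤s⁻¹ i<1+n) i≢n))
  where
  snoc-∈ : ∀ {k M} {l : Vec ℕ k} → i ∈ l → i ∈ (l ∷ʳ M)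
  snoc-∈ (here e) = here e
  snoc-∈ (there i∈) = there (snoc-∈ i∈)

distinct-map : ∀ (v : Vec (Fin N) k) → (∀ i j → lookup v i ≡ lookup v j → i ≡ j) → Distinct (Vec.map toℕ v)
distinct-map [] inj = []
distinct-map {N} (x ∷ v) inj = head≢ v (λ i e → contradiction (inj zero (suc i) e) λ ()) ∷
  distinct-map v (λ i j e → Fin.suc-injective (inj (suc i) (suc j) e))
  where
  head≢ : ∀ {k} (v : Vec (Fin N) k) → (∀ i → x ≢ lookup v i) → All (toℕ x ≢_) (Vec.map toℕ v)
  head≢ [] _ = []
  head≢ (y ∷ v) x≢ = (x≢ zero ∘ toℕ-injective) ∷ head≢ v (x≢ ∘ suc)

all-map-toℕ : ∀ {P : ℕ → Set} (v : Vec (Fin N) k) → (∀ (i : Fin N) → P (toℕ i)) → All P (Vec.map toℕ v)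
all-map-toℕ [] p = []
all-map-toℕ (x ∷ v) p = p x ∷ all-map-toℕ v p

fireworks-full : ∀ (w : Perm n) → IsPermutation w → Fireworks w →
                 ∃[ a ] (Full (ids n) (word w) a × Pointwise _≤_ (nonRecordVec (word w)) a)
fireworks-full {n} w perm fw = greedy (word w) (ids n) (distinct-map w perm) (fireworks-recordAscents w fw)
  (All.map occurs (ids-< n ≤-refl))
  (all-map-toℕ w λ i → ∈-ids n (toℕ<n i))
  (AllPairs.map (λ a<b → <⇒≢ a<b , λ b<a → contradiction b<a (<-asym a<b)) (ids-increasing n))
  where
  occurs : ∀ {i} → i < n → i ∈ word w
  occurs i<n with injective⇒surjective (lookup w) perm (Fin.fromℕ< i<n)
  ... | k , wk≡i = subst (_∈ word w) (trans (cong toℕ wk≡i) (Fin.toℕ-fromℕ< i<n)) (∈-map⁺ toℕ (∈-lookup k w))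

-- Row weights of the closed Rothe diagram

unique-⊆⇒↭ : ∀ {xs ys : List A} → Unique xs → Unique ys → xs ⊆ ys → ys ⊆ xs → xs ↭ ys
unique-⊆⇒↭ {xs = []} {[]} _ _ _ _ = ↭-refl
unique-⊆⇒↭ {xs = []} {y ∷ ys} _ _ _ ys⊆[] = contradiction (ys⊆[] (hereₗ refl)) λ ()
unique-⊆⇒↭ {A} {xs = x ∷ xs} {ys} uxs uys xs⊆ys ys⊆xs with ∈-∃++ (xs⊆ys (hereₗ refl))
... | ps , qs , refl = ↭-trans (prep x (unique-⊆⇒↭ (Listᴾ.tail uxs) (Listᴾ.tail u-shifted) to from)) (↭-sym shifted)
  where
  shifted : ps ++ x ∷ qs ↭ x ∷ ps ++ qs
  shifted = ↭.shift x ps qs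
  u-shifted : Unique (x ∷ ps ++ qs)
  u-shifted = ↭ₛ.Unique-resp-↭ (setoid A) (↭⇒↭ₛ shifted) uys
  strip : ∀ {y} {zs : List A} → y ∈ₗ x ∷ zs → x ≢ y → y ∈ₗ zs
  strip (hereₗ refl) x≢y = contradiction refl x≢y
  strip (thereₗ y∈) _ = y∈
  to : xs ⊆ ps ++ qs
  to y∈xs = strip (↭.∈-resp-↭ shifted (xs⊆ys (thereₗ y∈xs))) λ { refl → Unique[x∷xs]⇒x∉xs uxs y∈xs }
  from : ps ++ qs ⊆ xs
  from y∈ = strip (ys⊆xs (↭.∈-resp-↭ (↭-sym shifted) (thereₗ y∈))) λ { refl → Unique[x∷xs]⇒x∉xs u-shifted y∈ }

-- The diagram counts columns, that is values of w, while `nonRecords` runs through positions; this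
-- reindexes one count as the other.
perm-↭ : ∀ (w : Perm n) → IsPermutation w → List.allFin n ↭ List.tabulate (lookup w)
perm-↭ {n} w perm = unique-⊆⇒↭ (allFin⁺ n) (tabulate⁺ (perm _ _)) to (λ _ → ∈-allFin _)
  where
  to : List.allFin n ⊆ List.tabulate (lookup w)
  to {j} _ with injective⇒surjective (lookup w) perm j
  ... | i , refl = ∈-tabulate⁺ i

count : ∀ {P : A → Set} → Decidable P → List A → ℕ
count P? xs = List.length (List.filter P? xs)

module _ {P : A → Set} (P? : Decidable P) where

  count-accept : ∀ {x xs} → P x → count P? (x ∷ xs) ≡ suc (count P? xs)
  count-accept p = cong List.length (filter-accept P? p)

  count-reject : ∀ {x xs} → ¬ P x → count P? (x ∷ xs) ≡ count P? xs
  count-reject ¬p = cong List.length (filter-reject P? ¬p)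

module _ {P : Fin N → Set} (P? : Decidable P) where

  -- The threshold `m` summarises the letters before v, so that a head which is a record can take
  -- its place in the induction.
  count-nonRecords : ∀ (v : Vec (Fin N) k) (m : Fin N) →
    (∀ i → P (lookup v i) → lookup v i Fin.≤ m ⊎ ∃[ j ] (j Fin.< i × lookup v i Fin.≤ lookup v j)) →
    (∀ i → lookup v i Fin.≤ m ⊎ ∃[ j ] (j Fin.< i × lookup v i Fin.≤ lookup v j) → P (lookup v i)) →
    count P? (List.tabulate (lookup v)) ≡ nonRecords (toℕ m) (Vec.map toℕ v)
  count-nonRecords [] m to from = refl
  count-nonRecords (b ∷ v) m to from with toℕ m ℕ.<? toℕ b
  ... | yes m<b = trans (count-reject P? ¬Pb) (count-nonRecords v b to′ from′)
    where
    ¬Pb : ¬ P b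
    ¬Pb p with to zero p
    ... | inj₁ b≤m = <⇒≱ m<b b≤m
    to′ : ∀ i → P (lookup v i) → lookup v i Fin.≤ b ⊎ ∃[ j ] (j Fin.< i × lookup v i Fin.≤ lookup v j)
    to′ i p with to (suc i) p
    ... | inj₁ ≤m = inj₁ (≤-trans ≤m (<⇒≤ m<b))
    ... | inj₂ (zero , _ , ≤b) = inj₁ ≤b
    ... | inj₂ (suc j , j<i , le) = inj₂ (j , s≤s⁻¹ j<i , le)
    from′ : ∀ i → lookup v i Fin.≤ b ⊎ ∃[ j ] (j Fin.< i × lookup v i Fin.≤ lookup v j) → P (lookup v i)
    from′ i (inj₁ ≤b) = from (suc i) (inj₂ (zero , s≤s z≤n , ≤b))
    from′ i (inj₂ (j , j<i , le)) = from (suc i) (inj₂ (suc j , s≤s j<i , le))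
  ... | no m≮b = trans (count-accept P? (from zero (inj₁ (≮⇒≥ m≮b)))) (cong suc (count-nonRecords v m to′ from′))
    where
    to′ : ∀ i → P (lookup v i) → lookup v i Fin.≤ m ⊎ ∃[ j ] (j Fin.< i × lookup v i Fin.≤ lookup v j)
    to′ i p with to (suc i) p
    ... | inj₁ ≤m = inj₁ ≤m
    ... | inj₂ (zero , _ , ≤b) = inj₁ (≤-trans ≤b (≮⇒≥ m≮b))
    ... | inj₂ (suc j , j<i , le) = inj₂ (j , s≤s⁻¹ j<i , le)
    from′ : ∀ i → lookup v i Fin.≤ m ⊎ ∃[ j ] (j Fin.< i × lookup v i Fin.≤ lookup v j) → P (lookup v i)
    from′ i (inj₁ ≤m) = from (suc i) (inj₁ ≤m)
    from′ i (inj₂ (j , j<i , le)) = from (suc i) (inj₂ (suc j , s≤s j<i , le))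

  count-nonRecordVec : ∀ (v : Vec (Fin N) k) (r : Fin k) →
    (∀ i → P (lookup v i) → ∃[ j ] (r Fin.≤ j × j Fin.< i × lookup v i Fin.≤ lookup v j)) →
    (∀ i → ∃[ j ] (r Fin.≤ j × j Fin.< i × lookup v i Fin.≤ lookup v j) → P (lookup v i)) →
    count P? (List.tabulate (lookup v)) ≡ lookup (nonRecordVec (Vec.map toℕ v)) r
  count-nonRecordVec (b ∷ v) zero to from =
    trans (count-reject P? (λ p → contradiction (proj₁ (proj₂ (proj₂ (to zero p)))) λ ())) (count-nonRecords v b to′ from′)
    where
    to′ : ∀ i → P (lookup v i) → lookup v i Fin.≤ b ⊎ ∃[ j ] (j Fin.< i × lookup v i Fin.≤ lookup v j)
    to′ i p with to (suc i) p
    ... | zero , _ , _ , ≤b = inj₁ ≤b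
    ... | suc j , _ , j<i , le = inj₂ (j , s≤s⁻¹ j<i , le)
    from′ : ∀ i → lookup v i Fin.≤ b ⊎ ∃[ j ] (j Fin.< i × lookup v i Fin.≤ lookup v j) → P (lookup v i)
    from′ i (inj₁ ≤b) = from (suc i) (zero , z≤n , s≤s z≤n , ≤b)
    from′ i (inj₂ (j , j<i , le)) = from (suc i) (suc j , z≤n , s≤s j<i , le)
  count-nonRecordVec (b ∷ v) (suc r) to from =
    trans (count-reject P? (λ p → contradiction (proj₁ (proj₂ (proj₂ (to zero p)))) λ ())) (count-nonRecordVec v r to′ from′)
    where
    to′ : ∀ i → P (lookup v i) → ∃[ j ] (r Fin.≤ j × j Fin.< i × lookup v i Fin.≤ lookup v j)
    to′ i p with to (suc i) p
    ... | suc j , r≤j , j<i , le = j , s≤s⁻¹ r≤j , s≤s⁻¹ j<i , le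
    from′ : ∀ i → ∃[ j ] (r Fin.≤ j × j Fin.< i × lookup v i Fin.≤ lookup v j) → P (lookup v i)
    from′ i (j , r≤j , j<i , le) = from (suc i) (suc j , s≤s r≤j , s≤s j<i , le)

wtClosureD≡nonRecordVec : ∀ (w : Perm n) → IsPermutation w → wtClosureD w ≡ nonRecordVec (word w)
wtClosureD≡nonRecordVec {n} w perm = trans (tabulate-cong row-count) (tabulate∘lookup _)
  where
  row-count : ∀ r → count (InClosureD? w r) (List.allFin n) ≡ lookup (nonRecordVec (word w)) r
  row-count r = trans (↭.↭-length (↭.filter-↭ (InClosureD? w r) (perm-↭ w perm)))
    (count-nonRecordVec (InClosureD? w r) w r to from)
    where
    to : ∀ i → InClosureD w r (lookup w i) → ∃[ j ] (r Fin.≤ j × j Fin.< i × lookup w i Fin.≤ lookup w j)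
    to i (j , r≤j , (k , wk≡wi , j<k) , wi<wj) =
      j , r≤j , subst (j Fin.<_) (perm k i wk≡wi) j<k , <⇒≤ wi<wj
    from : ∀ i → ∃[ j ] (r Fin.≤ j × j Fin.< i × lookup w i Fin.≤ lookup w j) → InClosureD w r (lookup w i)
    from i (j , r≤j , j<i , wi≤wj) = j , r≤j , (i , refl , j<i) ,
      -- Non-records compare by ≤, boxes of the diagram by <; the values at distinct positions
      -- differ.
      ≤∧≢⇒< wi≤wj (λ e → Fin.<⇒≢ j<i (sym (perm i j (toℕ-injective e))))

-- Support in top degree

sum-mono : ∀ {a b : Vec ℕ n} → Pointwise _≤_ a b → Vec.sum a ≤ Vec.sum b
sum-mono [] = z≤n
sum-mono (le ∷ les) = +-mono-≤ le (sum-mono les)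

≤∧sum≥⇒≡ : ∀ {a b : Vec ℕ n} → Pointwise _≤_ a b → Vec.sum b ≤ Vec.sum a → a ≡ b
≤∧sum≥⇒≡ [] _ = refl
≤∧sum≥⇒≡ {a = x ∷ a} {y ∷ b} (x≤y ∷ les) sum≥ with m≤n⇒m<n∨m≡n x≤y
... | inj₁ x<y = contradiction (+-mono-<-≤ x<y (sum-mono les)) (≤⇒≯ sum≥)
... | inj₂ refl = cong (x ∷_) (≤∧sum≥⇒≡ les (+-cancelˡ-≤ x _ _ sum≥))

signed-nonzero : ∀ {ε} → ε ≢ 0ℤ → (f : Series n) → ∀ a → f a ≢ 0 → signed ε f a ≢ 0ℤ
signed-nonzero {ε = ε} ε≢0 f a fa≢0 e with ℤ.i*j≡0⇒i≡0∨j≡0 ε e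
... | inj₁ ε≡0 = ε≢0 ε≡0
... | inj₂ e′ with ℤ.i*j≡0⇒i≡0∨j≡0 (sgn a) e′
...   | inj₁ sgn≡0 = contradiction (trans (sym (sgn² a)) (cong (ℤ._* sgn a) sgn≡0)) λ ()
...   | inj₂ fa≡0 = fa≢0 (ℤ.+-injective fa≡0)

theorem3p14 : (n : ℕ) (w : Perm n) (f : Poly n) →
    IsPermutation w → Fireworks w → IsGroth w f →
    (a : Vec ℕ n) → (InSuppTop f a → a ≡ wtClosureD w) × (a ≡ wtClosureD w → InSuppTop f a)
theorem3p14 n w f perm fw groth a
  rewrite wtClosureD≡nonRecordVec w perm
  with ε , ε≢0 , f≗ ← groth-ψ groth
  with b , full , c≤b ← fireworks-full w perm fw
  = to , from
  where
  c = nonRecordVec (word w)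
  -- The greedy subword is only known to reach at least c; the upper bound for all subwords, applied
  -- to it, forces equality.
  b≡c : b ≡ c
  b≡c = ≤∧sum≥⇒≡ (full-bound full) (sum-mono c≤b)
  c∈supp : coeff f c ≢ 0ℤ
  c∈supp e = signed-nonzero ε≢0 (ψ (word w)) c
    (full-nonzero (subst (Full (ids n) (word w)) b≡c full)) (trans (sym (f≗ c)) e)
  supp≤c : ∀ a → coeff f a ≢ 0ℤ → Pointwise _≤_ a c
  supp≤c a ≢0 = full-bound (full-support (ids n) (word w) a λ ψ≡0 → ≢0 (trans (f≗ a)
    (trans (cong (λ z → ε ℤ.* (sgn a ℤ.* + z)) ψ≡0)
      (trans (cong (ε ℤ.*_) (ℤ.*-zeroʳ (sgn a))) (ℤ.*-zeroʳ ε)))))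
  to : InSuppTop f a → a ≡ c
  to (≢0 , top) = ≤∧sum≥⇒≡ (supp≤c a ≢0) (top c c∈supp)
  from : a ≡ c → InSuppTop f a
  from refl = c∈supp , λ b ≢0 → sum-mono (supp≤c b ≢0)
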